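{- Let $G$ be a simple, finite, connected partial 2-tree with edge weights $w:E(G)\to\mathbb{N}$ and a total order on $V(G)$, which is not outerplanar. Let $u,v\in V(G)$ be such that $G$ contains a subdivision of $K_{2,3}$ with branch-vertex bipartition $(\{u,v\},\{x,y,z\})$ and $G-\{u,v\}$ has at least three components. Let $P=lsp(u,v)$ and let $H$ be a component of $G-\{u,v\}$ with $V(P)\cap V(H)=\emptyset$ and $E(P)\cap E(H)=\emptyset$. Let $G_1$ be the graph with $V(G_1)=V(H)\cup V(P)$ and $E(G_1)=E(H)\cup E(P)\cup\{(a,b)\in E(G): a\in V(H), b\in\{u,v\}\}$, and let $G_2=G[V(G)\setminus V(H)]$, each with the restricted weights and induced order. Then $LSC(G)=LSC(G_1)\uplus LSC(G_2)$ (disjoint union).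
   Context: A partial 2-tree is a subgraph of a 2-tree, where 2-trees are built from $K_3$ by repeatedly adding a vertex adjacent to both endpoints of an existing edge. For a path $Q$, $w(Q)=\sum_{e\in E(Q)}w(e)$. In a weighted graph with totally ordered vertices, the lex shortest $a$–$b$ path is the unique $a$–$b$ path $Q$ such that for every other $a$–$b$ path $Q'$ exactly one of: (1) $w(Q')>w(Q)$; (2) $w(Q')=w(Q)$ and $|E(Q')|>|E(Q)|$; (3) $w(Q')=w(Q)$, $|E(Q')|=|E(Q)|$ and $\min(V(Q')\setminus V(Q))>\min(V(Q)\setminus V(Q'))$; in $G$ it is denoted $lsp(a,b)$. A cycle $C$ of a graph is lex short in that graph if for all $a,b\in V(C)$ the lex shortest $a$–$b$ path of that graph lies in $C$. $LSC(F)$ denotes the set of lex short cycles of a graph $F$. $G[X]$ is the induced subgraph on $X$. -}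

module Defs where

open import Data.Nat using (ℕ; zero; suc; _+_; _∸_; _<_; _≤_)
open import Data.Fin using (Fin; inject₁; fromℕ)
open import Data.Bool using (Bool; T)
open import Data.List using (List; []; _∷_; _++_; head; last; length)
open import Data.List.Membership.Propositional using (_∈_; _∉_)
open import Data.List.Relation.Unary.All using (All)
open import Data.List.Relation.Unary.Linked using (Linked)
open import Data.List.Relation.Unary.AllPairs using (AllPairs)
open import Data.List.Relation.Unary.Unique.Propositional using (Unique)
open import Data.Maybe using (just)
open import Data.Product using (Σ; ∃; _×_; _,_)
open import Data.Sum using (_⊎_)
open import Data.Unit using (⊤)
open import Relation.Nullary using (¬_)
open import Relation.Binary.PropositionalEquality using (_≡_; _≢_)
open import Function using (Injective)

-- Graphs on the vertex universe Fin n.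
-- A (sub)graph is given by a vertex predicate and an (undirected)
-- edge predicate.  All graphs in the statement live inside one fixed
-- host graph G on Fin n, so they share the vertex universe, the weight
-- function w and the vertex order.

record Graph (n : ℕ) : Set₁ where
  constructor mkGraph
  field
    V : Fin n → Set
    E : Fin n → Fin n → Set
open Graph public

fromAdj : ∀ {n} → (Fin n → Fin n → Bool) → Graph n
fromAdj adj = mkGraph (λ _ → ⊤) (λ a b → T (adj a b))

IsPath : ∀ {n} → Graph n → Fin n → Fin n → List (Fin n) → Set
IsPath F a b Q =
  head Q ≡ just a × last Q ≡ just b × Unique Q × All (V F) Q × Linked (E F) Q

data Consec {A : Set} : List A → A → A → Set where
  here  : ∀ {x y xs} → Consec (x ∷ y ∷ xs) x y
  there : ∀ {x y z xs} → Consec xs y z → Consec (x ∷ xs) y z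

PathEdge : ∀ {n} → List (Fin n) → Fin n → Fin n → Set
PathEdge Q a b = Consec Q a b ⊎ Consec Q b a

close : ∀ {A : Set} → List A → List A
close []       = []
close (x ∷ xs) = x ∷ (xs ++ (x ∷ []))

IsCycle : ∀ {n} → Graph n → List (Fin n) → Set
IsCycle F C = 3 ≤ length C × Unique C × All (V F) C × Linked (E F) (close C)

CycEdge : ∀ {n} → List (Fin n) → Fin n → Fin n → Set
CycEdge C a b = Consec (close C) a b ⊎ Consec (close C) b a

weight : ∀ {n} → (Fin n → Fin n → ℕ) → List (Fin n) → ℕ
weight w []           = 0
weight w (x ∷ [])     = 0
weight w (x ∷ y ∷ xs) = w x y + weight w (y ∷ xs)

nEdges : ∀ {A : Set} → List A → ℕ
nEdges Q = length Q ∸ 1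

ExactlyOne : Set → Set → Set → Set
ExactlyOne A B C = (A × ¬ B × ¬ C) ⊎ (¬ A × B × ¬ C) ⊎ (¬ A × ¬ B × C)

IsMin : ∀ {n} → (Fin n → Fin n → Set) → (Fin n → Set) → Fin n → Set
IsMin _≺_ S m = S m × (∀ t → S t → m ≡ t ⊎ m ≺ t)

MinGreater : ∀ {n} → (Fin n → Fin n → Set) → List (Fin n) → List (Fin n) → Set
MinGreater _≺_ Q' Q =
  Σ _ λ a → Σ _ λ b →
    IsMin _≺_ (λ t → t ∈ Q' × t ∉ Q) a ×
    IsMin _≺_ (λ t → t ∈ Q × t ∉ Q') b × b ≺ a

IsLSP : ∀ {n} → (Fin n → Fin n → Set) → (Fin n → Fin n → ℕ) →
        Graph n → Fin n → Fin n → List (Fin n) → Set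
IsLSP _≺_ w F a b Q =
  IsPath F a b Q ×
  (∀ Q' → IsPath F a b Q' → Q' ≢ Q →
     ExactlyOne (weight w Q < weight w Q')
                (weight w Q' ≡ weight w Q × nEdges Q < nEdges Q')
                (weight w Q' ≡ weight w Q × nEdges Q' ≡ nEdges Q ×
                 MinGreater _≺_ Q' Q))

IsLSC : ∀ {n} → (Fin n → Fin n → Set) → (Fin n → Fin n → ℕ) →
        Graph n → List (Fin n) → Set
IsLSC _≺_ w F C =
  IsCycle F C ×
  (∀ a b → a ∈ C → b ∈ C →
     Σ (List _) λ Q → IsLSP _≺_ w F a b Q ×
       (∀ t → t ∈ Q → t ∈ C) × (∀ x y → PathEdge Q x y → CycEdge C x y))

Connected : ∀ {n} → Graph n → Set
Connected F = ∀ x y → V F x → V F y → Σ (List _) λ Q → IsPath F x y Q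

delete2 : ∀ {n} → Graph n → Fin n → Fin n → Graph n
delete2 F u v = mkGraph (λ t → V F t × t ≢ u × t ≢ v)
                        (λ a b → E F a b × (a ≢ u × a ≢ v) × (b ≢ u × b ≢ v))

induced : ∀ {n} → Graph n → (Fin n → Set) → Graph n
induced F X = mkGraph (λ t → V F t × X t) (λ a b → E F a b × X a × X b)

Reach : ∀ {n} → Graph n → Fin n → Fin n → Set
Reach F x y = Σ (List _) λ Q → IsPath F x y Q

compV : ∀ {n} → Graph n → Fin n → Fin n → Set
compV F h t = Reach F h t

component : ∀ {n} → Graph n → Fin n → Graph n
component F h = induced F (compV F h)

AtLeast3Components : ∀ {n} → Graph n → Set
AtLeast3Components F =
  Σ _ λ t₁ → Σ _ λ t₂ → Σ _ λ t₃ →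
    V F t₁ × V F t₂ × V F t₃ ×
    ¬ Reach F t₁ t₂ × ¬ Reach F t₁ t₃ × ¬ Reach F t₂ t₃

-- Outerplanarity: the vertices can be placed on a circle (positions π)
-- so that the edges, drawn as chords, do not cross.
Outerplanar : ∀ {n} → Graph n → Set
Outerplanar {n} F =
  Σ (Fin n → ℕ) λ π → Injective _≡_ _≡_ π ×
    (∀ a b c d → E F a b → E F c d →
       ¬ (π a < π c × π c < π b × π b < π d))

-- 2-trees, built from K₃ by repeatedly adding a new vertex adjacent to
-- both ends of an existing edge (the new vertex is the last one of Fin).
mutual
  data TwoTree : ℕ → Set where
    triangle : TwoTree 3
    extend   : ∀ {m} (t : TwoTree m) (a b : Fin m) → TEdge t a b → TwoTree (suc m)

  TEdge : ∀ {m} → TwoTree m → Fin m → Fin m → Set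
  TEdge triangle x y = x ≢ y
  TEdge (extend {m} t a b _) x y =
    (Σ (Fin m) λ x' → Σ (Fin m) λ y' →
       x ≡ inject₁ x' × y ≡ inject₁ y' × TEdge t x' y')
    ⊎ (x ≡ fromℕ m × (y ≡ inject₁ a ⊎ y ≡ inject₁ b))
    ⊎ (y ≡ fromℕ m × (x ≡ inject₁ a ⊎ x ≡ inject₁ b))

Partial2Tree : ∀ {n} → Graph n → Set
Partial2Tree {n} F =
  Σ ℕ λ m → Σ (TwoTree m) λ T → Σ (Fin n → Fin m) λ f →
    Injective _≡_ _≡_ f × (∀ a b → E F a b → TEdge T (f a) (f b))

InternallyDisjoint : ∀ {n} → (Fin n × Fin n × List (Fin n)) →
                     (Fin n × Fin n × List (Fin n)) → Set
InternallyDisjoint (a , b , p) (c , d , q) =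
  ∀ t → t ∈ p → t ∈ q → (t ≡ a ⊎ t ≡ b) × (t ≡ c ⊎ t ≡ d)

K23Subdivision : ∀ {n} → Graph n → Fin n → Fin n → Fin n → Fin n → Fin n → Set
K23Subdivision F u v x y z =
  AllPairs _≢_ (u ∷ v ∷ x ∷ y ∷ z ∷ []) ×
  Σ (List _) λ pux → Σ (List _) λ puy → Σ (List _) λ puz →
  Σ (List _) λ pvx → Σ (List _) λ pvy → Σ (List _) λ pvz →
    IsPath F u x pux × IsPath F u y puy × IsPath F u z puz ×
    IsPath F v x pvx × IsPath F v y pvy × IsPath F v z pvz ×
    AllPairs InternallyDisjoint
      ((u , x , pux) ∷ (u , y , puy) ∷ (u , z , puz) ∷
       (v , x , pvx) ∷ (v , y , pvy) ∷ (v , z , pvz) ∷ [])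

G₁ : ∀ {n} → Graph n → Fin n → Fin n → Fin n → List (Fin n) → Graph n
G₁ G u v h P =
  mkGraph (λ t → V H t ⊎ t ∈ P)
          (λ a b → E H a b ⊎ PathEdge P a b ⊎
                   (E G a b × ((V H a × (b ≡ u ⊎ b ≡ v)) ⊎
                               (V H b × (a ≡ u ⊎ a ≡ v)))))
  where H = component (delete2 G u v) h

G₂ : ∀ {n} → Graph n → Fin n → Fin n → Fin n → Graph n
G₂ G u v h = induced G (λ t → ¬ V (component (delete2 G u v) h) t)

{-# OPTIONS --safe #-}

-- The lexicographic tie-breaking is encoded in a single additive, symmetric and positive edge
-- cost, so that lex shortest paths are exactly the strictly cheapest walks and their segments are
-- again strictly cheapest.  Hence a cheapest walk of G that meets P twice follows P in between.
-- A cheapest walk between vertices of G₁ (of G₂) that left this subgraph would do so between two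
-- vertices of P, so it does not leave; therefore lex short cycles of G₁ and G₂ are lex short in G.
-- Conversely, a lex short cycle of G through a vertex p of the component H and an edge xy avoiding
-- H contains u and v, hence P; since P avoids p, it traverses xy.  A cycle lex short in both
-- G₁ and G₂ would have all its edges on the path P.
module Submission where

open import Defs
open import Data.Nat using (ℕ; zero; suc; _+_; _*_; _∸_; _^_; _≤_; _<_; z≤n; s≤s; s≤s⁻¹)
open import Data.Nat.Properties hiding (_≟_; <-cmp)
open import Data.Nat.Properties using () renaming (_≟_ to _≟ℕ_; <-cmp to <-cmpℕ)
open import Data.Nat.Induction using (<-wellFounded; Acc; acc)
open import Data.Nat.ListAction using (sum)
open import Data.Nat.ListAction.Properties using (sum-++; sum-↭)
open import Data.Nat.Tactic.RingSolver using (solve-∀)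
open import Data.Fin using (Fin)
open import Data.Fin.Properties using (_≟_)
import Data.Fin.Properties as Fin
open import Data.Bool using (Bool; false; T)
open import Data.Bool.Properties using (T?)
open import Data.Empty using (⊥)
open import Data.Unit using (tt)
open import Data.Maybe using (just)
open import Data.List using (List; []; _∷_; _++_; _∷ʳ_; last; length; map; filter; reverse; allFin)
open import Data.List.Properties
  using (length-++; length-tabulate; map-++; ≡-dec; ++-assoc;
         ++-cancelˡ; ++-cancelʳ; ∷-injectiveʳ; unfold-reverse; reverse-involutive)
open import Data.List.Membership.Propositional using (_∈_; _∉_; find)
open import Data.List.Membership.Propositional.Properties
  using (∈-∃++; ∈-filter⁺; ∈-filter⁻; ∈-allFin; ∈-++⁺ˡ; ∈-++⁺ʳ; ∈-++⁻)
open import Data.List.Relation.Unary.Any as Any using (here; there)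
import Data.List.Relation.Unary.Any.Properties as Any
open import Data.List.Relation.Unary.All as All using (All; []; _∷_)
open import Data.List.Relation.Unary.All.Properties using (¬Any⇒All¬)
open import Data.List.Relation.Unary.AllPairs using ([]; _∷_)
open import Data.List.Relation.Unary.Linked as Linked using (Linked; []; [-]; _∷_)
open import Data.List.Relation.Unary.Unique.Propositional using (Unique)
import Data.List.Relation.Unary.Unique.Propositional.Properties as Unique
open import Data.List.Relation.Binary.Permutation.Propositional
  using (_↭_; ↭-refl; ↭-sym; ↭-trans; ↭-reflexive; prep; ↭⇒↭ₛ)
open import Data.List.Relation.Binary.Permutation.Propositional.Properties
  using (shift; ∈-resp-↭; ↭-length; map⁺; ++-comm; ∷↭∷ʳ)
import Data.List.Relation.Binary.Permutation.Setoid.Properties as PermutationSetoid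
open import Data.Product using (Σ; ∃; ∃₂; _×_; _,_; proj₁; proj₂)
open import Data.Sum using (_⊎_; inj₁; inj₂; [_,_]; swap)
open import Function.Bundles using (_⇔_; mk⇔)
open import Relation.Nullary using (¬_; Dec; yes; no; contradiction; ¬?; _×-dec_; _⊎-dec_)
import Relation.Nullary.Decidable as Dec
open import Relation.Binary.Definitions using (tri<; tri≈; tri>)
open import Relation.Binary.Structures using (IsStrictTotalOrder)
open import Relation.Binary.PropositionalEquality
  using (_≡_; _≢_; refl; sym; trans; cong; cong₂; subst; subst₂; setoid; module ≡-Reasoning)

-- Two features of the definition resist cutting and pasting: its third clause compares least
-- elements of set differences, and paths compete only with paths, while exchanging a piece of a
-- path can repeat a vertex. Powers of two deal with the first: they turn a vertex set into a binary
-- number whose leading digit belongs to the smallest vertex. Passing to walks deals with the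
-- second: as every edge cost is positive, deleting a loop makes a walk strictly cheaper, so a path
-- that beats all other paths beats all other walks. In the passage from a subgraph to `G`, no lex
-- shortest path of `G` is at hand to compare with. The comparison runs instead by well-founded
-- induction on the cost of the walks of `G`; this is why `Cheapest`, which permits ties, stands
-- beside `StrictlyCheapest`.

-- Lists without repetition and sums over them

Unique⇒∉ : ∀ {A : Set} {x : A} {xs} → Unique (x ∷ xs) → x ∉ xs
Unique⇒∉ (x∉ ∷ _) x∈ = All.lookup x∉ x∈ refl

∉⇒Unique : ∀ {A : Set} {x : A} {xs} → x ∉ xs → Unique xs → Unique (x ∷ xs)
∉⇒Unique x∉ xs! = ¬Any⇒All¬ _ x∉ ∷ xs!

Unique-disjoint : ∀ {A : Set} {x : A} xs {ys} → Unique (xs ++ ys) → x ∈ xs → x ∉ ys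
Unique-disjoint (_ ∷ xs) (p ∷ _) (here refl) x∈ys = All.lookup p (∈-++⁺ʳ xs x∈ys) refl
Unique-disjoint (_ ∷ xs) (_ ∷ q) (there x∈xs) x∈ys = Unique-disjoint xs q x∈xs x∈ys

∈⇒↭ : ∀ {A : Set} {x : A} {ys} → x ∈ ys → ∃ λ zs → ys ↭ x ∷ zs
∈⇒↭ x∈ with as , bs , refl ← ∈-∃++ x∈ = as ++ bs , shift _ as bs

Unique-resp-↭ : ∀ {A : Set} {xs ys : List A} → xs ↭ ys → Unique xs → Unique ys
Unique-resp-↭ {A} p = PermutationSetoid.Unique-resp-↭ (setoid A) (↭⇒↭ₛ p)

-- Pigeonhole in a form that keeps the complement `zs`: it yields the length bounds and also splits
-- a path into the vertices shared with another path and the remaining ones.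
Unique-⊆⇒↭ : ∀ {A : Set} {xs ys : List A} → Unique xs → (∀ {t} → t ∈ xs → t ∈ ys) →
             ∃ λ zs → ys ↭ xs ++ zs
Unique-⊆⇒↭ [] _ = _ , ↭-refl
Unique-⊆⇒↭ xs!@(_ ∷ xs!′) sub
  with as , p ← ∈⇒↭ (sub (here refl))
  with zs , q ← Unique-⊆⇒↭ xs!′ (λ t∈ →
         Any.tail (λ { refl → Unique⇒∉ xs! t∈ }) (∈-resp-↭ p (sub (there t∈))))
  = zs , ↭-trans p (prep _ q)

Unique-⊆⇒length≤ : ∀ {A : Set} {xs ys : List A} → Unique xs → (∀ {t} → t ∈ xs → t ∈ ys) →
                   length xs ≤ length ys
Unique-⊆⇒length≤ {xs = xs} {ys} xs! sub with zs , p ← Unique-⊆⇒↭ xs! sub =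
  subst (length xs ≤_) (sym (trans (↭-length p) (length-++ xs))) (m≤m+n _ _)

Unique⇒length≤n : ∀ {n} {xs : List (Fin n)} → Unique xs → length xs ≤ n
Unique⇒length≤n {n} {xs} xs! =
  subst (length xs ≤_) (length-tabulate {n = n} (λ i → i)) (Unique-⊆⇒length≤ xs! (λ _ → ∈-allFin _))

sum-map-↭ : ∀ {A : Set} (f : A → ℕ) {xs ys} → xs ↭ ys → sum (map f xs) ≡ sum (map f ys)
sum-map-↭ f p = sum-↭ (map⁺ f p)

sum-map-++ : ∀ {A : Set} (f : A → ℕ) xs ys → sum (map f (xs ++ ys)) ≡ sum (map f xs) + sum (map f ys)
sum-map-++ f xs ys = trans (cong sum (map-++ f xs ys)) (sum-++ (map f xs) (map f ys))

∈⇒≤sum : ∀ {A : Set} (f : A → ℕ) {x xs} → x ∈ xs → f x ≤ sum (map f xs)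
∈⇒≤sum f (here refl) = m≤m+n _ _
∈⇒≤sum f (there x∈) = ≤-trans (∈⇒≤sum f x∈) (m≤n+m _ _)

-- In the step to `suc k`, at most one element has exponent `k`, by injectivity; the others sum to
-- less than a second `2 ^ k`.
sum-2^< : ∀ {A : Set} (f : A → ℕ) → (∀ {x y} → f x ≡ f y → x ≡ y) →
          ∀ k {xs} → Unique xs → (∀ {x} → x ∈ xs → f x < k) → sum (map (λ x → 2 ^ f x) xs) < 2 ^ k
sum-2^< f inj zero {[]} _ _ = s≤s z≤n
sum-2^< f inj zero {x ∷ xs} _ lt = contradiction (lt (here refl)) λ ()
sum-2^< f inj (suc k) {xs} xs! lt with Any.any? (λ x → f x ≟ℕ k) xs
... | no none = <-≤-trans
        (sum-2^< f inj k xs! λ x∈ → ≤∧≢⇒< (s≤s⁻¹ (lt x∈)) λ e → none (Any.map (λ { refl → e }) x∈))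
        (m≤m+n _ _)
... | yes some with x , x∈ , fx≡k ← find some
               with zs , p ← ∈⇒↭ x∈
               with zs!@(_ ∷ zs!′) ← Unique-resp-↭ p xs! = begin-strict
    sum (map (λ x → 2 ^ f x) xs)            ≡⟨ sum-map-↭ (λ x → 2 ^ f x) p ⟩
    2 ^ f x + sum (map (λ x → 2 ^ f x) zs)  ≡⟨ cong (λ i → 2 ^ i + _) fx≡k ⟩
    2 ^ k + sum (map (λ x → 2 ^ f x) zs)    <⟨ +-monoʳ-< (2 ^ k) (sum-2^< f inj k zs!′ λ y∈ →
                                                  ≤∧≢⇒< (s≤s⁻¹ (lt (∈-resp-↭ (↭-sym p) (there y∈))))
                                                        λ e → Unique⇒∉ zs! (subst (_∈ zs) (inj (trans e (sym fx≡k))) y∈)) ⟩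
    2 ^ k + 2 ^ k                           ≤⟨ +-monoʳ-≤ (2 ^ k) (m≤m+n _ 0) ⟩
    2 ^ k + (2 ^ k + 0)                     ∎
  where open ≤-Reasoning

-- The lexicographic order as a single number

module LexCost {n : ℕ} {_≺_ : Fin n → Fin n → Set} (sto : IsStrictTotalOrder _≡_ _≺_)
               (w : Fin n → Fin n → ℕ) where

  open import Data.List.Membership.DecPropositional (_≟_ {n}) using (_∈?_)
  open IsStrictTotalOrder sto using (compare) renaming (_<?_ to _≺?_; trans to ≺-trans; irrefl to ≺-irrefl)

  later : Fin n → List (Fin n)
  later t = filter (t ≺?_) (allFin n)

  -- Counted from the top of the order, so that an earlier vertex gets the larger power of two.
  rank : Fin n → ℕ
  rank t = length (later t)

  ∷-later! : ∀ t → Unique (t ∷ later t)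
  ∷-later! t = ∉⇒Unique (λ t∈ → ≺-irrefl refl (proj₂ (∈-filter⁻ (t ≺?_) {xs = allFin n} t∈)))
                        (Unique.filter⁺ (t ≺?_) (Unique.allFin⁺ n))

  rank-anti-mono : ∀ {s t} → s ≺ t → rank t < rank s
  rank-anti-mono {s} {t} s≺t = Unique-⊆⇒length≤ (∷-later! t) λ where
    (here refl) → ∈-filter⁺ (s ≺?_) (∈-allFin t) s≺t
    (there x∈) → ∈-filter⁺ (s ≺?_) (∈-allFin _)
                   (≺-trans s≺t (proj₂ (∈-filter⁻ (t ≺?_) {xs = allFin n} x∈)))

  rank<n : ∀ t → rank t < n
  rank<n t = Unique⇒length≤n (∷-later! t)

  rank-injective : ∀ {s t} → rank s ≡ rank t → s ≡ t
  rank-injective {s} {t} e with compare s t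
  ... | tri< s≺t _ _ = contradiction (sym e) (<⇒≢ (rank-anti-mono s≺t))
  ... | tri≈ _ s≡t _ = s≡t
  ... | tri> _ _ t≺s = contradiction e (<⇒≢ (rank-anti-mono t≺s))

  -- For a list without repetition this is the binary number whose digits mark its vertices,
  -- smallest vertex first; between paths of equal weight and length, the larger number wins.
  bonus : List (Fin n) → ℕ
  bonus Q = sum (map (λ t → 2 ^ rank t) Q)

  Difference : List (Fin n) → List (Fin n) → Fin n → Set
  Difference Q Q' t = t ∈ Q × t ∉ Q'

  module _ {Q Q' : List (Fin n)} (Q! : Unique Q) (Q'! : Unique Q') where

    common : List (Fin n)
    common = filter (_∈? Q') Q

    difference : ∀ {Q} → Unique Q → (∀ {t} → t ∈ common → t ∈ Q) →
                 ∃ λ Z → Q ↭ common ++ Z × Unique Z × (∀ {t} → t ∈ Z → t ∈ Q × t ∉ common)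
    difference {R} R! sub
      with Z , p ← Unique-⊆⇒↭ (Unique.filter⁺ (_∈? Q') Q!) sub
      = Z , p , Z! common (Unique-resp-↭ p R!) , λ t∈ → ∈-resp-↭ (↭-sym p) (∈-++⁺ʳ common t∈)
          , λ t∈′ → Unique-disjoint common (Unique-resp-↭ p R!) t∈′ t∈
      where
      Z! : ∀ {Z} xs → Unique (xs ++ Z) → Unique Z
      Z! [] u = u
      Z! (_ ∷ xs) (_ ∷ u) = Z! xs u

    -- The common part cancels from the two bonuses, so `Z` and `Z'` alone decide the comparison.
    record Decomposition : Set where
      field
        {Z Z'} : List (Fin n)
        Q↭  : Q ↭ common ++ Z
        Q'↭ : Q' ↭ common ++ Z'
        Z'! : Unique Z'
        ∈Z⇒ : ∀ {t} → t ∈ Z → Difference Q Q' t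
        ∈Z'⇒ : ∀ {t} → t ∈ Z' → Difference Q' Q t
        ⇒∈Z : ∀ {t} → Difference Q Q' t → t ∈ Z
        ⇒∈Z' : ∀ {t} → Difference Q' Q t → t ∈ Z'

    decomposition : Decomposition
    decomposition
      with Z , p , _ , f ← difference Q! (λ t∈ → proj₁ (∈-filter⁻ (_∈? Q') t∈))
      with Z' , p' , Z'! , f' ← difference Q'! (λ t∈ → proj₂ (∈-filter⁻ (_∈? Q') {xs = Q} t∈))
      = record
      { Q↭ = p ; Q'↭ = p' ; Z'! = Z'!
      ; ∈Z⇒ = λ t∈ → proj₁ (f t∈) , λ t∈′ → proj₂ (f t∈) (∈-filter⁺ (_∈? Q') (proj₁ (f t∈)) t∈′)
      ; ∈Z'⇒ = λ t∈ → proj₁ (f' t∈) , λ t∈′ → proj₂ (f' t∈) (∈-filter⁺ (_∈? Q') t∈′ (proj₁ (f' t∈)))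
      ; ⇒∈Z = λ (t∈ , t∉) → other (∈-resp-↭ p t∈) λ t∈′ → t∉ (proj₂ (∈-filter⁻ (_∈? Q') {xs = Q} t∈′))
      ; ⇒∈Z' = λ (t∈ , t∉) → other (∈-resp-↭ p' t∈) λ t∈′ → t∉ (proj₁ (∈-filter⁻ (_∈? Q') t∈′))
      }
      where
      other : ∀ {t Y} → t ∈ common ++ Y → t ∉ common → t ∈ Y
      other t∈ t∉ with ∈-++⁻ common t∈
      ... | inj₁ t∈′ = contradiction t∈′ t∉
      ... | inj₂ t∈′ = t∈′

    open Decomposition decomposition

    bonus-Q : bonus Q ≡ bonus common + bonus Z
    bonus-Q = trans (sum-map-↭ _ Q↭) (sum-map-++ _ common Z)

    bonus-Q' : bonus Q' ≡ bonus common + bonus Z'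
    bonus-Q' = trans (sum-map-↭ _ Q'↭) (sum-map-++ _ common Z')

    -- The smallest vertex of the symmetric difference contributes more than all later vertices.
    MinGreater⇒bonus< : MinGreater _≺_ Q' Q → bonus Q' < bonus Q
    MinGreater⇒bonus< (a , b , (_ , a-min) , (b∈ , _) , b≺a) = begin-strict
      bonus Q'                  ≡⟨ bonus-Q' ⟩
      bonus common + bonus Z'   <⟨ +-monoʳ-< (bonus common)
                                     (sum-2^< rank rank-injective (rank b) Z'! λ t∈ → after (a-min _ (∈Z'⇒ t∈))) ⟩
      bonus common + 2 ^ rank b ≤⟨ +-monoʳ-≤ (bonus common) (∈⇒≤sum (λ t → 2 ^ rank t) (⇒∈Z b∈)) ⟩
      bonus common + bonus Z    ≡⟨ bonus-Q ⟨
      bonus Q                   ∎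
      where
      open ≤-Reasoning
      after : ∀ {t} → a ≡ t ⊎ a ≺ t → rank t < rank b
      after (inj₁ refl) = rank-anti-mono b≺a
      after (inj₂ a≺t) = rank-anti-mono (≺-trans b≺a a≺t)

  minimum : ∀ x xs → ∃ (IsMin _≺_ (_∈ x ∷ xs))
  minimum x [] = x , here refl , λ { t (here refl) → inj₁ refl }
  minimum x (y ∷ ys) with m , m∈ , m-min ← minimum y ys | compare x m
  ... | tri< x≺m _ _ = x , here refl , λ where
          t (here refl) → inj₁ refl
          t (there t∈) → inj₂ (below (m-min t t∈))
    where
    below : ∀ {t} → m ≡ t ⊎ m ≺ t → x ≺ t
    below (inj₁ refl) = x≺m
    below (inj₂ m≺t) = ≺-trans x≺m m≺t
  ... | tri≈ _ refl _ = m , there m∈ , λ where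
          t (here refl) → inj₁ refl
          t (there t∈) → m-min t t∈
  ... | tri> _ _ m≺x = m , there m∈ , λ where
          t (here refl) → inj₂ m≺x
          t (there t∈) → m-min t t∈

  -- Equal lengths force `Z` and `Z'` to have equal size. If both are empty, the bonuses agree;
  -- otherwise both have a minimum, and the wrong order of the minima is refuted by
  -- `MinGreater⇒bonus<` with the roles exchanged.
  bonus<⇒MinGreater : ∀ {Q Q'} → Unique Q → Unique Q' → length Q ≡ length Q' →
                      bonus Q' < bonus Q → MinGreater _≺_ Q' Q
  bonus<⇒MinGreater {Q} {Q'} Q! Q'! len lt = go Z Z' refl refl
    where
    open Decomposition (decomposition Q! Q'!)
    X = common Q! Q'!
    sizes : length Z ≡ length Z'
    sizes = +-cancelˡ-≡ (length X) _ _
      (trans (sym (trans (↭-length Q↭) (length-++ X))) (trans len (trans (↭-length Q'↭) (length-++ X))))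
    go : ∀ Y Y' → Y ≡ Z → Y' ≡ Z' → MinGreater _≺_ Q' Q
    go [] [] e e' = contradiction lt (<-irrefl (sum-map-↭ _ (↭-trans Q'↭ (↭-trans
      (↭-reflexive (cong (X ++_) (trans (sym e') e))) (↭-sym Q↭)))))
    go [] (_ ∷ _) e e' = contradiction (trans (cong length e) (trans sizes (cong length (sym e')))) λ ()
    go (_ ∷ _) [] e e' = contradiction (trans (cong length e) (trans sizes (cong length (sym e')))) λ ()
    go (z ∷ zs) (z' ∷ zs') e e'
      with m , m∈ , m-min ← minimum z zs | a , a∈ , a-min ← minimum z' zs'
      = compared (∈Z⇒ (subst (m ∈_) e m∈) , λ t d → m-min t (subst (t ∈_) (sym e) (⇒∈Z d)))
                 (∈Z'⇒ (subst (a ∈_) e' a∈) , λ t d → a-min t (subst (t ∈_) (sym e') (⇒∈Z' d)))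
      where
      compared : ∀ {m a} → IsMin _≺_ (Difference Q Q') m → IsMin _≺_ (Difference Q' Q) a → MinGreater _≺_ Q' Q
      compared {m} {a} M A with compare m a
      ... | tri< m≺a _ _ = a , m , A , M , m≺a
      ... | tri≈ _ refl _ = contradiction (proj₁ (proj₁ A)) (proj₂ (proj₁ M))
      ... | tri> _ _ a≺m = contradiction lt (<-asym (MinGreater⇒bonus< Q'! Q! (m , a , M , A , a≺m)))

  -- The prices of k distinct vertices sum to k * 2 ^ n minus a bonus below 2 ^ n, so fewer
  -- vertices are cheaper, and among equally many those with the larger bonus; multiplied by
  -- scale, the weight takes precedence over both.
  scale : ℕ
  scale = suc (n * 2 ^ n)

  price : Fin n → ℕ
  price t = 2 ^ n ∸ 2 ^ rank t

  2^rank< : ∀ t → 2 ^ rank t < 2 ^ n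
  2^rank< t = ^-monoʳ-< 2 (s≤s (s≤s z≤n)) (rank<n t)

  price>0 : ∀ t → 0 < price t
  price>0 t = m<n⇒0<n∸m (2^rank< t)

  prices : List (Fin n) → ℕ
  prices Q = sum (map price Q)

  prices+bonus : ∀ Q → prices Q + bonus Q ≡ length Q * 2 ^ n
  prices+bonus [] = refl
  prices+bonus (t ∷ Q) = begin-equality
    price t + prices Q + (2 ^ rank t + bonus Q)   ≡⟨ interchange (price t) (prices Q) _ _ ⟩
    price t + 2 ^ rank t + (prices Q + bonus Q)   ≡⟨ cong₂ _+_ (m∸n+n≡m (<⇒≤ (2^rank< t))) (prices+bonus Q) ⟩
    2 ^ n + length Q * 2 ^ n                      ∎
    where
    open ≤-Reasoning
    interchange : ∀ a b c d → a + b + (c + d) ≡ a + c + (b + d)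
    interchange = solve-∀

  bonus<2^n : ∀ {Q} → Unique Q → bonus Q < 2 ^ n
  bonus<2^n Q! = sum-2^< rank rank-injective n Q! λ {t} _ → rank<n t

  prices<scale : ∀ {Q} → Unique Q → prices Q < scale
  prices<scale {Q} Q! = s≤s (≤-trans (m≤m+n _ (bonus Q)) (≤-trans (≤-reflexive (prices+bonus Q))
                              (*-monoˡ-≤ (2 ^ n) (Unique⇒length≤n Q!))))

  shorter⇒prices< : ∀ {Q Q'} → Unique Q' → length Q < length Q' → prices Q < prices Q'
  shorter⇒prices< {Q} {Q'} Q'! lt = +-cancelʳ-< (2 ^ n) _ _ (begin-strict
    prices Q + 2 ^ n            ≤⟨ +-monoˡ-≤ (2 ^ n) (m≤m+n _ (bonus Q)) ⟩
    prices Q + bonus Q + 2 ^ n  ≡⟨ trans (cong (_+ 2 ^ n) (prices+bonus Q)) (+-comm _ (2 ^ n)) ⟩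
    suc (length Q) * 2 ^ n      ≤⟨ *-monoˡ-≤ (2 ^ n) lt ⟩
    length Q' * 2 ^ n           ≡⟨ prices+bonus Q' ⟨
    prices Q' + bonus Q'        <⟨ +-monoʳ-< (prices Q') (bonus<2^n Q'!) ⟩
    prices Q' + 2 ^ n           ∎)
    where open ≤-Reasoning

  bonus<⇒prices< : ∀ {Q Q'} → length Q ≡ length Q' → bonus Q' < bonus Q → prices Q < prices Q'
  bonus<⇒prices< {Q} {Q'} len lt = +-cancelʳ-< (bonus Q') _ _ (begin-strict
    prices Q + bonus Q'   <⟨ +-monoʳ-< (prices Q) lt ⟩
    prices Q + bonus Q    ≡⟨ prices+bonus Q ⟩
    length Q * 2 ^ n      ≡⟨ cong (_* 2 ^ n) len ⟩
    length Q' * 2 ^ n     ≡⟨ prices+bonus Q' ⟨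
    prices Q' + bonus Q'  ∎)
    where open ≤-Reasoning

  prices<⇒bonus< : ∀ {Q Q'} → length Q ≡ length Q' → prices Q < prices Q' → bonus Q' < bonus Q
  prices<⇒bonus< {Q} {Q'} len lt = +-cancelˡ-< (prices Q) _ _ (begin-strict
    prices Q + bonus Q'   <⟨ +-monoˡ-< (bonus Q') lt ⟩
    prices Q' + bonus Q'  ≡⟨ prices+bonus Q' ⟩
    length Q' * 2 ^ n     ≡⟨ cong (_* 2 ^ n) len ⟨
    length Q * 2 ^ n      ≡⟨ prices+bonus Q ⟨
    prices Q + bonus Q    ∎)
    where open ≤-Reasoning

  total : List (Fin n) → ℕ
  total Q = scale * weight w Q + prices Q

  lighter⇒total< : ∀ {Q Q'} → Unique Q → weight w Q < weight w Q' → total Q < total Q'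
  lighter⇒total< {Q} {Q'} Q! lt = begin-strict
    scale * weight w Q + prices Q  <⟨ +-monoʳ-< (scale * weight w Q) (prices<scale Q!) ⟩
    scale * weight w Q + scale     ≡⟨ trans (+-comm _ scale) (sym (*-suc scale (weight w Q))) ⟩
    scale * suc (weight w Q)       ≤⟨ *-monoʳ-≤ scale lt ⟩
    scale * weight w Q'            ≤⟨ m≤m+n _ _ ⟩
    total Q'                       ∎
    where open ≤-Reasoning

  prices<⇒total< : ∀ {Q Q'} → weight w Q' ≡ weight w Q → prices Q < prices Q' → total Q < total Q'
  prices<⇒total< {Q} e lt = subst (λ k → total Q < scale * k + _) (sym e) (+-monoʳ-< (scale * weight w Q) lt)

  total<⇒prices< : ∀ {Q Q'} → weight w Q' ≡ weight w Q → total Q < total Q' → prices Q < prices Q'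
  total<⇒prices< {Q} e lt = +-cancelˡ-< (scale * weight w Q) _ _ (subst (λ k → total Q < scale * k + _) e lt)

  LexSmaller : List (Fin n) → List (Fin n) → Set
  LexSmaller Q Q' = ExactlyOne (weight w Q < weight w Q')
                               (weight w Q' ≡ weight w Q × nEdges Q < nEdges Q')
                               (weight w Q' ≡ weight w Q × nEdges Q' ≡ nEdges Q × MinGreater _≺_ Q' Q)

  module _ {x y : Fin n} {Q Q' : List (Fin n)} (Q! : Unique (x ∷ Q)) (Q'! : Unique (y ∷ Q')) where

    -- Both lists are given with a head because `nEdges` is a truncated subtraction: on nonempty
    -- lists it is the length of the tail and compares as `length` does.
    LexSmaller⇒total< : LexSmaller (x ∷ Q) (y ∷ Q') → total (x ∷ Q) < total (y ∷ Q')
    LexSmaller⇒total< (inj₁ (lt , _)) = lighter⇒total< {Q' = y ∷ Q'} Q! lt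
    LexSmaller⇒total< (inj₂ (inj₁ (_ , (e , lt) , _))) =
      prices<⇒total< {x ∷ Q} {y ∷ Q'} e (shorter⇒prices< {x ∷ Q} Q'! (s≤s lt))
    LexSmaller⇒total< (inj₂ (inj₂ (_ , _ , e , len , min))) =
      prices<⇒total< {x ∷ Q} {y ∷ Q'} e
        (bonus<⇒prices< {x ∷ Q} {y ∷ Q'} (cong suc (sym len)) (MinGreater⇒bonus< Q! Q'! min))

    total<⇒LexSmaller : total (x ∷ Q) < total (y ∷ Q') → LexSmaller (x ∷ Q) (y ∷ Q')
    total<⇒LexSmaller lt with <-cmpℕ (weight w (x ∷ Q)) (weight w (y ∷ Q'))
    ... | tri< a ¬b _ = inj₁ (a , (λ (e , _) → ¬b (sym e)) , λ (e , _) → ¬b (sym e))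
    ... | tri> _ _ c = contradiction lt (<-asym (lighter⇒total< {Q' = x ∷ Q} Q'! c))
    ... | tri≈ ¬a b _ with <-cmpℕ (length Q) (length Q')
    ...   | tri< a′ ¬b′ _ = inj₂ (inj₁ (¬a , (sym b , a′) , λ (_ , e , _) → ¬b′ (sym e)))
    ...   | tri> _ _ c′ = contradiction lt (<-asym
              (prices<⇒total< {y ∷ Q'} {x ∷ Q} b (shorter⇒prices< {y ∷ Q'} Q! (s≤s c′))))
    ...   | tri≈ ¬a′ b′ _ = inj₂ (inj₂ (¬a , (λ (_ , l) → ¬a′ l) , sym b , sym b′ ,
              bonus<⇒MinGreater Q! Q'! (cong suc b′)
                (prices<⇒bonus< {x ∷ Q} {y ∷ Q'} (cong suc b′) (total<⇒prices< {x ∷ Q} {y ∷ Q'} (sym b) lt))))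

  -- `total` is not additive, since a concatenation shares the vertex at the joint. Charging the
  -- vertex prices to the edges is additive; as an interior vertex is then paid on two edges, the
  -- edge weights are doubled to match.
  cost : Fin n → Fin n → ℕ
  cost x y = 2 * (scale * w x y) + (price x + price y)

-- Walks

infixr 5 _∷_

-- A walk with vertex sequence a ∷ xs is indexed by a and xs, so that walks concatenate as lists do.
data Walk {A : Set} (R : A → A → Set) : A → List A → A → Set where
  []  : ∀ {a} → Walk R a [] a
  _∷_ : ∀ {a b c xs} → R a c → Walk R c xs b → Walk R a (c ∷ xs) b

module _ {A : Set} {R : A → A → Set} where

  infixr 5 _++ʷ_

  _++ʷ_ : ∀ {a b c xs ys} → Walk R a xs c → Walk R c ys b → Walk R a (xs ++ ys) b
  [] ++ʷ q = q
  (r ∷ p) ++ʷ q = r ∷ (p ++ʷ q)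

  Walk-split : ∀ {a b t xs} → Walk R a xs b → t ∈ a ∷ xs →
               ∃₂ λ ys zs → xs ≡ ys ++ zs × Walk R a ys t × Walk R t zs b
  Walk-split p (here refl) = [] , _ , refl , [] , p
  Walk-split (r ∷ p) (there t∈) with ys , zs , refl , p₁ , p₂ ← Walk-split p t∈ =
    _ ∷ ys , zs , refl , r ∷ p₁ , p₂

  Walk-split-edge : ∀ {a b x y xs} → Walk R a xs b → Consec (a ∷ xs) x y →
                    ∃₂ λ ys zs → xs ≡ ys ++ y ∷ zs × Walk R a ys x × R x y × Walk R y zs b
  Walk-split-edge (r ∷ p) here = [] , _ , refl , [] , r , p
  Walk-split-edge (r ∷ p) (there c) with ys , zs , refl , p₁ , r′ , p₂ ← Walk-split-edge p c =
    _ ∷ ys , zs , refl , r ∷ p₁ , r′ , p₂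

  target∈ : ∀ {a b xs} → Walk R a xs b → b ∈ a ∷ xs
  target∈ [] = here refl
  target∈ (_ ∷ p) = there (target∈ p)

  Consec-middle : ∀ {a x ys} → Walk R a ys x → ∀ y zs → Consec (a ∷ ys ++ y ∷ zs) x y
  Consec-middle [] y zs = here
  Consec-middle (_ ∷ p) y zs = there (Consec-middle p y zs)

  Consec-++ʷ : ∀ {a c x y xs ys} → Walk R a xs c → Consec (c ∷ ys) x y → Consec (a ∷ xs ++ ys) x y
  Consec-++ʷ [] con = con
  Consec-++ʷ (_ ∷ p) con = there (Consec-++ʷ p con)

  Walk-map : ∀ {S : A → A → Set} {a b xs} → (∀ {x y} → Consec (a ∷ xs) x y → R x y → S x y) →
             Walk R a xs b → Walk S a xs b
  Walk-map f [] = []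
  Walk-map f (r ∷ p) = f here r ∷ Walk-map (λ c → f (there c)) p

  Consec⇒related : ∀ {a b x y xs} → Walk R a xs b → Consec (a ∷ xs) x y → R x y
  Consec⇒related (r ∷ _) here = r
  Consec⇒related (_ ∷ p) (there c) = Consec⇒related p c

  Walk⇒Linked : ∀ {a b xs} → Walk R a xs b → Linked R (a ∷ xs)
  Walk⇒Linked [] = [-]
  Walk⇒Linked (r ∷ []) = r ∷ [-]
  Walk⇒Linked (r ∷ p@(_ ∷ _)) = r ∷ Walk⇒Linked p

  Linked⇒Walk : ∀ {a b xs} → Linked R (a ∷ xs) → last (a ∷ xs) ≡ just b → Walk R a xs b
  Linked⇒Walk [-] refl = []
  Linked⇒Walk (r ∷ l@[-]) e = r ∷ Linked⇒Walk l e
  Linked⇒Walk (r ∷ l@(_ ∷ _)) e = r ∷ Linked⇒Walk l e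

  Walk⇒last : ∀ {a b xs} → Walk R a xs b → last (a ∷ xs) ≡ just b
  Walk⇒last [] = refl
  Walk⇒last (_ ∷ []) = refl
  Walk⇒last (_ ∷ p@(_ ∷ _)) = Walk⇒last p

Consec⇒∈ : ∀ {A : Set} {x y : A} {xs} → Consec xs x y → x ∈ xs × y ∈ xs
Consec⇒∈ here = here refl , there (here refl)
Consec⇒∈ (there c) with x∈ , y∈ ← Consec⇒∈ c = there x∈ , there y∈

Consec-++⁺ˡ : ∀ {A : Set} {x y : A} {xs ys} → Consec xs x y → Consec (xs ++ ys) x y
Consec-++⁺ˡ here = here
Consec-++⁺ˡ (there c) = there (Consec-++⁺ˡ c)

Consec-++⁺ʳ : ∀ {A : Set} {x y : A} xs {ys} → Consec ys x y → Consec (xs ++ ys) x y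
Consec-++⁺ʳ [] c = c
Consec-++⁺ʳ (_ ∷ xs) c = there (Consec-++⁺ʳ xs c)

Consec-++⁻ : ∀ {A : Set} {x y : A} xs {z zs} → Consec (xs ++ z ∷ zs) x y →
             Consec (xs ∷ʳ z) x y ⊎ Consec (z ∷ zs) x y
Consec-++⁻ [] c = inj₂ c
Consec-++⁻ (_ ∷ []) here = inj₁ here
Consec-++⁻ (_ ∷ []) (there c) = inj₂ c
Consec-++⁻ (_ ∷ _ ∷ xs) here = inj₁ here
Consec-++⁻ (_ ∷ xs@(_ ∷ _)) (there c) with Consec-++⁻ xs c
... | inj₁ c′ = inj₁ (there c′)
... | inj₂ c′ = inj₂ c′

Consec-reverse : ∀ {A : Set} {x y : A} xs → Consec (reverse xs) x y → Consec xs y x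
Consec-reverse (a ∷ []) (there ())
Consec-reverse (a ∷ b ∷ ys) c =
  [ (λ c′ → there (Consec-reverse (b ∷ ys) (subst (λ l → Consec l _ _) (sym (unfold-reverse b ys)) c′)))
  , (λ { here → here ; (there (there ())) })
  ] (Consec-++⁻ (reverse ys) (subst (λ l → Consec l _ _) eq c))
  where
  eq : reverse (a ∷ b ∷ ys) ≡ reverse ys ++ b ∷ a ∷ []
  eq = trans (unfold-reverse a (b ∷ ys))
             (trans (cong (_∷ʳ a) (unfold-reverse b ys)) (++-assoc (reverse ys) (b ∷ []) (a ∷ [])))

-- Costs of walks and the exchange of segments

module Weighted {n : ℕ} {R : Fin n → Fin n → Set} {e : Fin n → Fin n → ℕ} where

  weight-++ : ∀ {a c xs} → Walk R a xs c → ∀ ys → weight e (a ∷ xs ++ ys) ≡ weight e (a ∷ xs) + weight e (c ∷ ys)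
  weight-++ [] ys = refl
  weight-++ {a} (_∷_ {c = c} r p) ys = trans (cong (e a c +_) (weight-++ p ys)) (sym (+-assoc (e a c) _ _))

  -- The middle piece is moved to the front so that exchanging it for another walk with the same
  -- ends is a single cancellation.
  weight-++₃ : ∀ {a c d xs ys} → Walk R a xs c → Walk R c ys d → ∀ zs →
               weight e (a ∷ xs ++ ys ++ zs) ≡ weight e (c ∷ ys) + (weight e (a ∷ xs) + weight e (d ∷ zs))
  weight-++₃ {a} {c} {d} {xs} {ys} p q zs = begin
    weight e (a ∷ xs ++ ys ++ zs)                                   ≡⟨ weight-++ p (ys ++ zs) ⟩
    weight e (a ∷ xs) + weight e (c ∷ ys ++ zs)                     ≡⟨ cong (weight e (a ∷ xs) +_) (weight-++ q zs) ⟩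
    weight e (a ∷ xs) + (weight e (c ∷ ys) + weight e (d ∷ zs))     ≡⟨ regroup (weight e (a ∷ xs)) (weight e (c ∷ ys)) (weight e (d ∷ zs)) ⟩
    weight e (c ∷ ys) + (weight e (a ∷ xs) + weight e (d ∷ zs))     ∎
    where
    open ≡-Reasoning
    regroup : ∀ i j k → i + (j + k) ≡ j + (i + k)
    regroup = solve-∀

  Walk-reverse : (∀ {x y} → R x y → R y x) → (∀ x y → e x y ≡ e y x) → ∀ {a b xs} → Walk R a xs b →
                 ∃ λ ys → Walk R b ys a × b ∷ ys ≡ reverse (a ∷ xs) × weight e (b ∷ ys) ≡ weight e (a ∷ xs)
  Walk-reverse R-sym e-sym [] = [] , [] , refl , refl
  Walk-reverse R-sym e-sym {a} {b} (_∷_ {c = c} {xs = xs} r p)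
    with ys , q , eq , wt ← Walk-reverse R-sym e-sym p
    = ys ∷ʳ a , q ++ʷ (R-sym r ∷ []) , trans (cong (_∷ʳ a) eq) (sym (unfold-reverse a (c ∷ xs)))
    , trans (weight-++ q (a ∷ [])) (trans (+-comm (weight e (b ∷ ys)) _)
        (cong₂ _+_ (trans (+-identityʳ _) (e-sym c a)) wt))

  open import Data.List.Membership.DecPropositional (_≟_ {n}) using (_∈?_)

  -- Loop erasure from the far end: if `a` recurs on the path already built, everything before that
  -- recurrence is dropped, which saves at least the positive cost of the first edge.
  Walk⇒path : (∀ x y → 0 < e x y) → ∀ {a b xs} → Walk R a xs b →
              ∃ λ ys → Walk R a ys b × Unique (a ∷ ys) × (ys ≡ xs ⊎ weight e (a ∷ ys) < weight e (a ∷ xs))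
  Walk⇒path pos [] = [] , [] , [] ∷ [] , inj₁ refl
  Walk⇒path pos {a} (_∷_ {c = c} {xs = xs} r p) with ys , q , q! , cmp ← Walk⇒path pos p | a ∈? c ∷ ys
  ... | no a∉ = c ∷ ys , r ∷ q , ∉⇒Unique a∉ q! , longer cmp
    where
    longer : ∀ {ys} → ys ≡ xs ⊎ weight e (c ∷ ys) < weight e (c ∷ xs) →
             c ∷ ys ≡ c ∷ xs ⊎ weight e (a ∷ c ∷ ys) < weight e (a ∷ c ∷ xs)
    longer (inj₁ refl) = inj₁ refl
    longer (inj₂ lt) = inj₂ (+-monoʳ-< (e a c) lt)
  ... | yes a∈ with ys₁ , ys₂ , refl , q₁ , q₂ ← Walk-split q a∈ =
    ys₂ , q₂ , suffix! q₁ q! , inj₂ (begin-strict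
      weight e (a ∷ ys₂)                      ≤⟨ m≤n+m _ _ ⟩
      weight e (c ∷ ys₁) + weight e (a ∷ ys₂) ≡⟨ weight-++ q₁ ys₂ ⟨
      weight e (c ∷ ys₁ ++ ys₂)               ≤⟨ below cmp ⟩
      weight e (c ∷ xs)                       <⟨ +-monoˡ-< (weight e (c ∷ xs)) (pos a c) ⟩
      e a c + weight e (c ∷ xs)               ∎)
    where
    open ≤-Reasoning
    suffix! : ∀ {c t ys zs} → Walk R c ys t → Unique (c ∷ ys ++ zs) → Unique (t ∷ zs)
    suffix! [] u = u
    suffix! (_ ∷ p) (_ ∷ u) = suffix! p u
    below : ∀ {ys} → ys ≡ xs ⊎ weight e (c ∷ ys) < weight e (c ∷ xs) → weight e (c ∷ ys) ≤ weight e (c ∷ xs)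
    below (inj₁ refl) = ≤-refl
    below (inj₂ lt) = <⇒≤ lt

module _ {n : ℕ} (R : Fin n → Fin n → Set) (e : Fin n → Fin n → ℕ) where

  -- The competitors are all walks, since a path with one piece exchanged is in general only a walk.
  Cheapest : Fin n → List (Fin n) → Fin n → Set
  Cheapest a xs b = ∀ ys → Walk R a ys b → ¬ weight e (a ∷ ys) < weight e (a ∷ xs)

  StrictlyCheapest : Fin n → List (Fin n) → Fin n → Set
  StrictlyCheapest a xs b = ∀ ys → Walk R a ys b → ys ≢ xs → weight e (a ∷ xs) < weight e (a ∷ ys)

module CheapestWalks {n : ℕ} {R : Fin n → Fin n → Set} {e : Fin n → Fin n → ℕ}
  (R-sym : ∀ {x y} → R x y → R y x) (e-sym : ∀ x y → e x y ≡ e y x) where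

  open Weighted {R = R} {e = e}

  -- A rival of the middle piece, put back between the two outer pieces, is a rival of the whole
  -- walk, and the outer costs cancel.
  segment-strict : ∀ {a b c d A S D} → Walk R a A c → Walk R c S d → Walk R d D b →
                   StrictlyCheapest R e a (A ++ S ++ D) b → StrictlyCheapest R e c S d
  segment-strict {A = A} {S} {D} p q r strict T q′ T≢S = +-cancelʳ-< _ _ _
    (subst₂ _<_ (weight-++₃ p q D) (weight-++₃ p q′ D)
      (strict (A ++ T ++ D) (p ++ʷ q′ ++ʷ r) λ eq → T≢S (++-cancelʳ D T S (++-cancelˡ A _ _ eq))))

  segment-cheapest : ∀ {a b c d A S D} → Walk R a A c → Walk R c S d → Walk R d D b →
                     Cheapest R e a (A ++ S ++ D) b → Cheapest R e c S d
  segment-cheapest {A = A} {S} {D} p q r cheap T q′ lt = cheap (A ++ T ++ D) (p ++ʷ q′ ++ʷ r)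
    (subst₂ _<_ (sym (weight-++₃ p q′ D)) (sym (weight-++₃ p q D)) (+-monoˡ-< _ lt))

  reverse-strict : ∀ {a b xs ys} → b ∷ ys ≡ reverse (a ∷ xs) → weight e (b ∷ ys) ≡ weight e (a ∷ xs) →
                   StrictlyCheapest R e a xs b → StrictlyCheapest R e b ys a
  reverse-strict {a} {b} {xs} {ys} eq wt strict zs r zs≢ys
    with zs′ , r′ , eq′ , wt′ ← Walk-reverse R-sym e-sym r
    = subst₂ _<_ (sym wt) wt′ (strict zs′ r′ λ { refl → zs≢ys (∷-injectiveʳ
        (trans (trans (sym (reverse-involutive (b ∷ zs))) (sym (cong reverse eq′))) (sym eq))) })

  -- Directed from `c` to `d` whichever comes first on `P`; hence `edges` is stated with the
  -- undirected `PathEdge`.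
  record Segment (P : List (Fin n)) (c d : Fin n) : Set where
    field
      {via} : List (Fin n)
      walk : Walk R c via d
      strict : StrictlyCheapest R e c via d
      vertices : ∀ {t} → t ∈ c ∷ via → t ∈ P
      edges : ∀ {x y} → Consec (c ∷ via) x y → PathEdge P x y

  segment : ∀ {u v c d xs} → Walk R u xs v → StrictlyCheapest R e u xs v →
            c ∈ u ∷ xs → d ∈ u ∷ xs → Segment (u ∷ xs) c d
  segment {u} {v} {c} {d} p strict c∈ d∈
    with A , X , refl , p₁ , p₂ ← Walk-split p c∈
    with ∈-++⁻ (u ∷ A) d∈
  ... | inj₂ d∈X with B , D , refl , q₁ , q₂ ← Walk-split p₂ (there d∈X) = record
    { walk = q₁
    ; strict = segment-strict p₁ q₁ q₂ strict
    ; vertices = λ where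
        (here refl) → c∈
        (there t∈) → ∈-++⁺ʳ (u ∷ A) (∈-++⁺ˡ t∈)
    ; edges = λ con → inj₁ (Consec-++ʷ p₁ (Consec-++⁺ˡ con))
    }
  -- Here `d` occurs no later than `c` on the path, so the piece is reversed.
  ... | inj₁ d∈A with A₁ , A₂ , refl , q₁ , q₂ ← Walk-split p₁ d∈A
                 with Y , r , eq , wt ← Walk-reverse R-sym e-sym q₂ = record
    { walk = r
    ; strict = reverse-strict eq wt (segment-strict q₁ q₂ p₂
        (subst (λ l → StrictlyCheapest R e u l v) (++-assoc A₁ A₂ X) strict))
    ; vertices = λ t∈ → vs (Any.reverse⁻ (subst (_ ∈_) eq t∈))
    ; edges = λ con → inj₂ (Consec-++⁺ˡ (Consec-++ʷ q₁ (Consec-reverse (d ∷ A₂) (subst (λ l → Consec l _ _) eq con))))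
    }
    where
    vs : ∀ {t} → t ∈ d ∷ A₂ → t ∈ u ∷ (A₁ ++ A₂) ++ X
    vs (here refl) = d∈
    vs (there t∈) = ∈-++⁺ˡ (there (∈-++⁺ʳ A₁ t∈))

  -- Were `S` different from the segment of `P`, strictness would make that segment cheaper,
  -- although a piece of a cheapest walk is itself cheapest.
  cheapest-follows : ∀ {a b c d A S D P} → Walk R a A c → Walk R c S d → Walk R d D b →
                     Cheapest R e a (A ++ S ++ D) b → Segment P c d →
                     (∀ {t} → t ∈ c ∷ S → t ∈ P) × (∀ {x y} → Consec (c ∷ S) x y → PathEdge P x y)
  cheapest-follows {S = S} p q r cheap seg with ≡-dec _≟_ S (Segment.via seg)
  ... | yes refl = Segment.vertices seg , Segment.edges seg
  ... | no S≢ = contradiction (Segment.strict seg S q S≢)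
                              (segment-cheapest p q r cheap _ (Segment.walk seg))

-- Paths, walks and reachability in a graph

Linked⇒related : ∀ {A : Set} {R : A → A → Set} {x y xs} → Linked R xs → Consec xs x y → R x y
Linked⇒related (r ∷ _) here = r
Linked⇒related (_ ∷ l) (there c) = Linked⇒related l c

-- A `Graph` does not tie its edges to its vertices. With this property a walk starting at a vertex
-- of the graph stays among its vertices, so the edges are all that has to be tracked.
Closed : ∀ {n} → Graph n → Set
Closed F = ∀ {x y} → E F x y → V F y

Walk⇒V : ∀ {n} {F : Graph n} → Closed F → ∀ {a b xs} → V F a → Walk (E F) a xs b → All (V F) (a ∷ xs)
Walk⇒V cl va [] = va ∷ []
Walk⇒V cl va (r ∷ p) = va ∷ Walk⇒V cl (cl r) p

IsPath⇒Walk : ∀ {n} {F : Graph n} {a b Q} → IsPath F a b Q →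
              ∃ λ xs → Q ≡ a ∷ xs × Walk (E F) a xs b × Unique (a ∷ xs) × V F a
IsPath⇒Walk {Q = []} (() , _)
IsPath⇒Walk {Q = _ ∷ xs} (refl , l , Q! , va ∷ _ , r) = xs , refl , Linked⇒Walk r l , Q! , va

Walk⇒IsPath : ∀ {n} {F : Graph n} → Closed F → ∀ {a b xs} → V F a → Walk (E F) a xs b → Unique (a ∷ xs) →
              IsPath F a b (a ∷ xs)
Walk⇒IsPath {F = F} cl va p Q! = refl , Walk⇒last p , Q! , Walk⇒V {F = F} cl va p , Walk⇒Linked p

walk≤? : ∀ {n} {R : Fin n → Fin n → Set} → (∀ x y → Dec (R x y)) →
         ∀ k a b → Dec (∃ λ xs → length xs ≤ k × Walk R a xs b)
walk≤? R? zero a b = Dec.map′ (λ { refl → [] , z≤n , [] }) (λ { ([] , _ , []) → refl }) (a ≟ b)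
walk≤? R? (suc k) a b = Dec.map′
  (λ { (inj₁ refl) → [] , z≤n , []
     ; (inj₂ (c , r , xs , l , p)) → c ∷ xs , s≤s l , r ∷ p })
  (λ { ([] , _ , []) → inj₁ refl
     ; (c ∷ xs , s≤s l , r ∷ p) → inj₂ (c , r , xs , l , p) })
  (a ≟ b ⊎-dec Fin.any? (λ c → R? a c ×-dec walk≤? R? k c b))

module _ {n : ℕ} {F : Graph n} (cl : Closed F) where

  Walk⇒Reach : ∀ {a b xs} → V F a → Walk (E F) a xs b → Reach F a b
  -- Only the loop erasure is wanted; the constant cost 1 serves to invoke it.
  Walk⇒Reach va p with ys , q , q! , _ ← Weighted.Walk⇒path {e = λ _ _ → 1} (λ _ _ → s≤s z≤n) p =
    _ , Walk⇒IsPath {F = F} cl va q q!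

  -- A path has at most `n` vertices, so the search among walks of at most `n` edges is exhaustive.
  -- It makes membership in `H` decidable, on which the separation arguments split.
  Reach? : (∀ x y → Dec (E F x y)) → ∀ {a} → V F a → ∀ b → Dec (Reach F a b)
  Reach? E? va b = Dec.map′ (λ (_ , _ , p) → Walk⇒Reach va p) bounded (walk≤? E? n _ b)
    where
    bounded : Reach F _ b → _
    bounded (_ , Q) with xs , refl , p , Q! , _ ← IsPath⇒Walk {F = F} Q =
      xs , ≤-trans (n≤1+n _) (Unique⇒length≤n Q!) , p

  Reach⇒V : ∀ {a b} → Reach F a b → V F b
  Reach⇒V (_ , Q) with xs , refl , p , _ , va ← IsPath⇒Walk {F = F} Q =
    All.lookup (Walk⇒V {F = F} cl va p) (target∈ p)

  Reach-step : ∀ {a b c} → Reach F a b → E F b c → Reach F a c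
  Reach-step (_ , Q) r with xs , refl , p , _ , va ← IsPath⇒Walk {F = F} Q = Walk⇒Reach va (p ++ʷ (r ∷ []))

-- Lex shortest paths as strictly cheapest walks

module LexShortest {n : ℕ} {_≺_ : Fin n → Fin n → Set} (sto : IsStrictTotalOrder _≡_ _≺_)
                   (w : Fin n → Fin n → ℕ) where

  open LexCost sto w

  cost-sym : (∀ x y → w x y ≡ w y x) → ∀ x y → cost x y ≡ cost y x
  cost-sym w-sym x y = cong₂ (λ i j → 2 * (scale * i) + j) (w-sym x y) (+-comm (price x) (price y))

  cost>0 : ∀ x y → 0 < cost x y
  cost>0 x y = ≤-trans (price>0 x) (≤-trans (m≤m+n _ (price y)) (m≤n+m _ (2 * (scale * w x y))))

  -- Each edge pays the prices of both its ends, so that a walk pays twice for its interior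
  -- vertices but only once for its ends.
  weight-cost : ∀ {R : Fin n → Fin n → Set} {a b xs} → Walk R a xs b →
                weight cost (a ∷ xs) + (price a + price b) ≡ 2 * total (a ∷ xs)
  weight-cost {a = a} [] = base (price a) scale
    where
    base : ∀ p k → 0 + (p + p) ≡ 2 * (k * 0 + (p + 0))
    base = solve-∀
  weight-cost {a = a} {b} (_∷_ {c = c} {xs = xs} r p) = begin
    cost a c + weight cost (c ∷ xs) + (price a + price b)
      ≡⟨ regroup (2 * (scale * w a c)) (price a) (price c) (weight cost (c ∷ xs)) (price b) ⟩
    2 * (scale * w a c) + 2 * price a + (weight cost (c ∷ xs) + (price c + price b))
      ≡⟨ cong (2 * (scale * w a c) + 2 * price a +_) (weight-cost p) ⟩
    2 * (scale * w a c) + 2 * price a + 2 * total (c ∷ xs)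
      ≡⟨ collect scale (w a c) (price a) (weight w (c ∷ xs)) (prices (c ∷ xs)) ⟩
    2 * total (a ∷ c ∷ xs) ∎
    where
    open ≡-Reasoning
    regroup : ∀ k i j m l → k + (i + j) + m + (i + l) ≡ k + 2 * i + (m + (j + l))
    regroup = solve-∀
    collect : ∀ k i p j q → 2 * (k * i) + 2 * p + 2 * (k * j + q) ≡ 2 * (k * (i + j) + (p + q))
    collect = solve-∀

  module _ {R S : Fin n → Fin n → Set} {a b xs ys} (p : Walk R a xs b) (q : Walk S a ys b) where

    cost<⇒total< : weight cost (a ∷ xs) < weight cost (a ∷ ys) → total (a ∷ xs) < total (a ∷ ys)
    cost<⇒total< lt = *-cancelˡ-< 2 _ _ (subst₂ _<_ (weight-cost p) (weight-cost q) (+-monoˡ-< _ lt))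

    total<⇒cost< : total (a ∷ xs) < total (a ∷ ys) → weight cost (a ∷ xs) < weight cost (a ∷ ys)
    total<⇒cost< lt = +-cancelʳ-< _ _ _ (subst₂ _<_ (sym (weight-cost p)) (sym (weight-cost q)) (*-monoʳ-< 2 lt))

  module _ {F : Graph n} where

    -- A rival walk is first reduced to a path. If that path is `xs` itself, the rival had a loop
    -- and so costs more; any other path loses to `xs` by assumption.
    IsLSP⇒strict : Closed F → ∀ {a b xs} → IsLSP _≺_ w F a b (a ∷ xs) → StrictlyCheapest (E F) cost a xs b
    IsLSP⇒strict cl {a} {b} {xs} (Q , shortest) ys q ys≢xs
      with zs , refl , p , Q! , va ← IsPath⇒Walk {F = F} Q
      with zs , r , r! , cmp ← Weighted.Walk⇒path cost>0 q
      = compared cmp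
      where
      path≢ : zs ≢ xs → weight cost (a ∷ xs) < weight cost (a ∷ zs)
      path≢ zs≢xs = total<⇒cost< p r (LexSmaller⇒total< Q! r!
        (shortest (a ∷ zs) (Walk⇒IsPath {F = F} cl va r r!) λ eq → zs≢xs (∷-injectiveʳ eq)))
      compared : zs ≡ ys ⊎ weight cost (a ∷ zs) < weight cost (a ∷ ys) → weight cost (a ∷ xs) < weight cost (a ∷ ys)
      compared (inj₁ refl) = path≢ ys≢xs
      compared (inj₂ lt) with ≡-dec _≟_ zs xs
      ... | yes refl = lt
      ... | no zs≢xs = <-trans (path≢ zs≢xs) lt

    strict⇒IsLSP : ∀ {a b xs} → IsPath F a b (a ∷ xs) → StrictlyCheapest (E F) cost a xs b → IsLSP _≺_ w F a b (a ∷ xs)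
    strict⇒IsLSP {a} {b} {xs} Q strict = Q , λ Q' path Q'≢Q → smaller Q' path Q'≢Q
      where
      smaller : ∀ Q' → IsPath F a b Q' → Q' ≢ a ∷ xs → LexSmaller (a ∷ xs) Q'
      smaller Q' path Q'≢Q
        with zs , refl , p , Q! , _ ← IsPath⇒Walk {F = F} Q
        with ys , refl , q , Q'! , _ ← IsPath⇒Walk {F = F} path
        = total<⇒LexSmaller Q! Q'! (cost<⇒total< p q (strict ys q λ { refl → Q'≢Q refl }))

    IsLSP-unique : Closed F → ∀ {a b P Q} → IsLSP _≺_ w F a b P → IsLSP _≺_ w F a b Q → P ≡ Q
    IsLSP-unique cl LP@(P , _) LQ@(Q , _)
      with xs , refl , p , _ ← IsPath⇒Walk {F = F} P | ys , refl , q , _ ← IsPath⇒Walk {F = F} Q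
      with ≡-dec _≟_ xs ys
    ... | yes refl = refl
    ... | no xs≢ys = contradiction (IsLSP⇒strict cl LP ys q λ e → xs≢ys (sym e)) (<-asym (IsLSP⇒strict cl LQ xs p xs≢ys))

  -- Lex short cycles of a graph and of its subgraphs

  record _⊑_ (F G : Graph n) : Set where
    field
      V⊆ : ∀ {t} → V F t → V G t
      E⊆ : ∀ {x y} → E F x y → E G x y
      closed : Closed F
      symmetric : ∀ {x y} → E F x y → E F y x

  module _ {F G : Graph n} (F⊑G : F ⊑ G) where

    open _⊑_ F⊑G

    IsPath-⊑ : ∀ {a b Q} → IsPath F a b Q → IsPath G a b Q
    IsPath-⊑ (hd , la , Q! , vs , es) = hd , la , Q! , All.map V⊆ vs , Linked.map E⊆ es

    -- The lex shortest paths of `G` between vertices of `C` lie on `C`, hence in `F`, where they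
    -- meet no new competitors.
    IsLSC-restrict : ∀ {C} → IsLSC _≺_ w G C → (∀ {t} → t ∈ C → V F t) →
                     (∀ {x y} → Consec (close C) x y → E F x y) → IsLSC _≺_ w F C
    IsLSC-restrict {C} ((3≤ , C! , _ , es) , lsps) C⊆V C⊆E =
      (3≤ , C! , All.tabulate C⊆V , linked (close C) C⊆E) , λ a b a∈ b∈ → restrict (lsps a b a∈ b∈)
      where
      linked : ∀ L → (∀ {x y} → Consec L x y → E F x y) → Linked (E F) L
      linked [] f = []
      linked (_ ∷ []) f = [-]
      linked (_ ∷ L@(_ ∷ _)) f = f here ∷ linked L (λ c → f (there c))
      cyc : ∀ {x y} → CycEdge C x y → E F x y
      cyc (inj₁ c) = C⊆E c
      cyc (inj₂ c) = symmetric (C⊆E c)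
      LSPWithinC : Graph n → Fin n → Fin n → Set
      LSPWithinC K a b = ∃ λ Q → IsLSP _≺_ w K a b Q ×
        (∀ t → t ∈ Q → t ∈ C) × (∀ x y → PathEdge Q x y → CycEdge C x y)
      restrict : ∀ {a b} → LSPWithinC G a b → LSPWithinC F a b
      restrict (Q , ((hd , la , Q! , _ , _) , shortest) , Q⊆C , QE⊆C) =
        Q , ((hd , la , Q! , All.tabulate (λ t∈ → C⊆V (Q⊆C _ t∈)) , linked Q (λ c → cyc (QE⊆C _ _ (inj₁ c))))
            , λ Q' p → shortest Q' (IsPath-⊑ p))
          , Q⊆C , QE⊆C

    -- By induction on the cost, a competitor no more expensive than xs is cheapest in G, so it stays in F.
    strict-extend : ∀ {a b xs} → (∀ {ys} → Walk (E G) a ys b → Cheapest (E G) cost a ys b → Walk (E F) a ys b) →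
                    StrictlyCheapest (E F) cost a xs b → StrictlyCheapest (E G) cost a xs b
    strict-extend {a} {b} {xs} stays strict ys = go ys (<-wellFounded _)
      where
      go : ∀ ys → Acc _<_ (weight cost (a ∷ ys)) → Walk (E G) a ys b → ys ≢ xs → weight cost (a ∷ xs) < weight cost (a ∷ ys)
      go ys (acc rec) p ys≢xs with weight cost (a ∷ xs) <? weight cost (a ∷ ys)
      ... | yes lt = lt
      ... | no ≮ = strict ys (stays p cheapest) ys≢xs
        where
        cheapest : Cheapest (E G) cost a ys b
        cheapest zs q lt with ≡-dec _≟_ zs xs
        ... | yes refl = ≮ lt
        ... | no zs≢xs = ≮ (<-trans (go zs (rec lt) q zs≢xs) lt)

    IsLSC-extend : (∀ {a b ys} → V F a → V F b → Walk (E G) a ys b → Cheapest (E G) cost a ys b → Walk (E F) a ys b) →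
                   ∀ {C} → IsLSC _≺_ w F C → IsLSC _≺_ w G C
    IsLSC-extend stays {C} ((3≤ , C! , vs , es) , lsps) =
      (3≤ , C! , All.map V⊆ vs , Linked.map E⊆ es) , lsps-G
      where
      lsps-G : ∀ a b → a ∈ C → b ∈ C → _
      lsps-G a b a∈ b∈ with Q , L@(path , _) , Q⊆C ← lsps a b a∈ b∈
                       with xs , refl , _ ← IsPath⇒Walk {F = F} path
        = Q , strict⇒IsLSP {F = G} (IsPath-⊑ path)
                (strict-extend (stays (All.lookup vs a∈) (All.lookup vs b∈)) (IsLSP⇒strict {F = F} closed L)) , Q⊆C

-- Cycles

Consec-++ʷ⁻ : ∀ {A : Set} {R : A → A → Set} {a c x y xs ys} → Walk R a xs c → Consec (a ∷ xs ++ ys) x y →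
              Consec (a ∷ xs) x y ⊎ Consec (c ∷ ys) x y
Consec-++ʷ⁻ [] con = inj₂ con
Consec-++ʷ⁻ (_ ∷ p) here = inj₁ here
Consec-++ʷ⁻ (_ ∷ p) (there con) with Consec-++ʷ⁻ p con
... | inj₁ c = inj₁ (there c)
... | inj₂ c = inj₂ c

Walk-unsnoc : ∀ {A : Set} {R : A → A → Set} {a b x xs} → Walk R a (x ∷ xs) b →
              ∃₂ λ ys z → x ∷ xs ≡ ys ∷ʳ b × Walk R a ys z
Walk-unsnoc (r ∷ []) = [] , _ , refl , []
Walk-unsnoc (r ∷ p@(_ ∷ _)) with ys , z , eq , q ← Walk-unsnoc p = _ ∷ ys , z , cong (_ ∷_) eq , r ∷ q

Walk-crossing : ∀ {A : Set} {R : A → A → Set} {a b xs} {S S′ : A → Set} → Walk R a xs b →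
                (∀ {t} → t ∈ a ∷ xs → S t ⊎ S′ t) → (∀ {t} → S t → ¬ S′ t) → S a → S′ b →
                ∃₂ λ x y → Consec (a ∷ xs) x y × S x × S′ y
Walk-crossing [] cover disj sa s′b = contradiction s′b (disj sa)
Walk-crossing (_∷_ {c = c} r p) cover disj sa s′b with cover (there (here refl))
... | inj₂ s′c = _ , c , here , sa , s′c
... | inj₁ sc with x , y , con , sx , s′y ← Walk-crossing p (λ t∈ → cover (there t∈)) disj sc s′b =
  x , y , there con , sx , s′y

Consec-close⇒∈ : ∀ {A : Set} {C : List A} {x y} → Consec (close C) x y → x ∈ C × y ∈ C
Consec-close⇒∈ {C = z ∷ zs} con with x∈ , y∈ ← Consec⇒∈ con = back x∈ , back y∈
  where
  back : ∀ {t} → t ∈ z ∷ zs ∷ʳ z → t ∈ z ∷ zs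
  back t∈ with ∈-++⁻ (z ∷ zs) t∈
  ... | inj₁ t∈′ = t∈′
  ... | inj₂ (here refl) = here refl

successor : ∀ {A : Set} {C : List A} {x} → x ∈ C → ∃ λ y → Consec (close C) x y
successor {C = z ∷ zs} = next (z ∷ zs)
  where
  next : ∀ xs {x w} → x ∈ xs → ∃ λ y → Consec (xs ∷ʳ w) x y
  next (_ ∷ []) (here refl) = _ , here
  next (_ ∷ _ ∷ _) (here refl) = _ , here
  next (_ ∷ xs) (there x∈) with y , c ← next xs x∈ = y , there c

last-∷ʳ : ∀ {A : Set} (xs : List A) x → last (xs ∷ʳ x) ≡ just x
last-∷ʳ [] x = refl
last-∷ʳ (_ ∷ []) x = refl
last-∷ʳ (_ ∷ xs@(_ ∷ _)) x = last-∷ʳ xs x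

-- The cycle C cut open at its edge xy.
record Opened {A : Set} (R : A → A → Set) (C : List A) (x y : A) : Set where
  field
    {rest} : List A
    walk : Walk R y rest x
    ↭C : y ∷ rest ↭ C
    to : ∀ {c d} → Consec (close C) c d → Consec (y ∷ rest) c d ⊎ (c ≡ x × d ≡ y)
    from : ∀ {c d} → Consec (y ∷ rest) c d → Consec (close C) c d

-- The closed walk starts and ends at `z`. Its piece from `y` on is followed by its piece up to `x`,
-- the two being joined at `z`.
open-at : ∀ {A : Set} {R : A → A → Set} {C : List A} {x y} → Linked R (close C) → Consec (close C) x y → Opened R C x y
open-at {R = R} {z ∷ zs} {x} {y} l con
  with ys , ws , eq , p , _ , q ← Walk-split-edge (Linked⇒Walk l (last-∷ʳ (z ∷ zs) z)) con
  = record
  { walk = q ++ʷ p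
  ; ↭C = ↭-trans (prep y (++-comm ws ys)) (↭-trans (↭-sym (shift y ys ws))
           (↭-trans (↭-reflexive (sym eq)) (↭-sym (∷↭∷ʳ z zs))))
  ; to = λ c → split q (Consec-++ʷ⁻ p (subst (λ l → Consec (z ∷ l) _ _) eq c))
  ; from = λ c → subst (λ l → Consec (z ∷ l) _ _) (sym eq) (join (Consec-++ʷ⁻ q c))
  }
  where
  split : ∀ {c d ys ws} → Walk R y ws z → Consec (z ∷ ys) c d ⊎ Consec (x ∷ y ∷ ws) c d →
          Consec (y ∷ ws ++ ys) c d ⊎ (c ≡ x × d ≡ y)
  split q (inj₁ c) = inj₁ (Consec-++ʷ q c)
  split _ (inj₂ here) = inj₂ (refl , refl)
  split _ (inj₂ (there c)) = inj₁ (Consec-++⁺ˡ c)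
  join : ∀ {c d ys ws} → Consec (y ∷ ws) c d ⊎ Consec (z ∷ ys) c d → Consec (z ∷ ys ++ y ∷ ws) c d
  join {ys = ys} (inj₁ c) = Consec-++⁺ʳ (z ∷ ys) c
  join (inj₂ c) = Consec-++⁺ˡ c

PathEdge-second : ∀ {n} {x y : Fin n} {P} → Unique (x ∷ P) → PathEdge (x ∷ P) x y → ∃ λ P′ → P ≡ y ∷ P′
PathEdge-second P! (inj₁ here) = _ , refl
PathEdge-second P! (inj₁ (there c)) = contradiction (proj₁ (Consec⇒∈ c)) (Unique⇒∉ P!)
PathEdge-second P! (inj₂ here) = contradiction (here refl) (Unique⇒∉ P!)
PathEdge-second P! (inj₂ (there c)) = contradiction (proj₂ (Consec⇒∈ c)) (Unique⇒∉ P!)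

-- The first vertex of the path on the cycle would need two distinct successors along the path.
cycle⊈path : ∀ {n} {F : Graph n} {C} → IsCycle F C → ∀ P → Unique P →
             ¬ (∀ {x y} → Consec (close C) x y → PathEdge P x y)
cycle⊈path {C = z ∷ zs} _ [] _ sub with sub (proj₂ (successor (here refl)))
... | inj₁ ()
... | inj₂ ()
cycle⊈path {n} {F} {C} cyc@(3≤ , C! , _ , l) (x ∷ P) P!@(_ ∷ P!′) sub with Any.any? (x ≟_) C
... | no x∉ = cycle⊈path {F = F} cyc P P!′ λ c → shorten (Consec-close⇒∈ c) (sub c)
  where
  shorten : ∀ {c d} → c ∈ C × d ∈ C → PathEdge (x ∷ P) c d → PathEdge P c d
  shorten (c∈ , _) (inj₁ here) = contradiction c∈ x∉
  shorten _ (inj₁ (there c)) = inj₁ c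
  shorten (_ , d∈) (inj₂ here) = contradiction d∈ x∉
  shorten _ (inj₂ (there c)) = inj₂ c
... | yes x∈ with y , con ← successor x∈ =
  two-neighbours (walk o) (Unique-resp-↭ (↭-sym (↭C o)) C!) (subst (3 ≤_) (sym (↭-length (↭C o))) 3≤) (from o)
  where
  open Opened
  o : Opened (E F) C x y
  o = open-at l con
  two-neighbours : ∀ {M} → Walk (E F) y M x → Unique (y ∷ M) → 3 ≤ length (y ∷ M) →
                   (∀ {c d} → Consec (y ∷ M) c d → Consec (close C) c d) → ⊥
  two-neighbours [] _ (s≤s ()) _
  -- The other neighbour `z` of `x` on the cycle is the vertex before `x` in the opened walk; length
  -- at least 3 keeps it apart from `y`.
  two-neighbours p@(_ ∷ _) u 3≤ from with ys , z , eq , q ← Walk-unsnoc p =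
    distinct q (subst (λ l → Unique (y ∷ l)) eq u) (subst (λ l → 3 ≤ length (y ∷ l)) eq 3≤)
      (same (PathEdge-second P! (sub con)) (PathEdge-second P!
        (swap (sub (from (subst (λ l → Consec (y ∷ l) z x) (sym eq) (Consec-middle q x [])))))))
    where
    same : ∀ {y z} → (∃ λ P′ → P ≡ y ∷ P′) → (∃ λ P′ → P ≡ z ∷ P′) → y ≡ z
    same (_ , refl) (_ , refl) = refl
    distinct : ∀ {ys z} → Walk (E F) y ys z → Unique (y ∷ ys ∷ʳ x) → 3 ≤ length (y ∷ ys ∷ʳ x) → y ≢ z
    distinct [] _ (s≤s (s≤s ())) _
    distinct (_ ∷ q) u _ refl = Unique⇒∉ u (∈-++⁺ˡ (target∈ q))

-- Separating H by u and v

module Separation {n : ℕ} {_≺_ : Fin n → Fin n → Set} (sto : IsStrictTotalOrder _≡_ _≺_)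
  (adj : Fin n → Fin n → Bool) (adj-sym : ∀ a b → adj a b ≡ adj b a)
  (w : Fin n → Fin n → ℕ) (w-sym : ∀ a b → w a b ≡ w b a)
  (u v : Fin n) (P : List (Fin n)) (P-lsp : IsLSP _≺_ w (fromAdj adj) u v P)
  (h : Fin n) (h≢u : h ≢ u) (h≢v : h ≢ v)
  (P∩H=∅ : ∀ t → t ∈ P → ¬ V (component (delete2 (fromAdj adj) u v) h) t) where

  open LexCost sto w using (cost)
  open LexShortest sto w

  G G-uv : Graph n
  G = fromAdj adj
  G-uv = delete2 G u v

  H : Fin n → Set
  H = compV G-uv h

  E-sym : ∀ {x y} → E G x y → E G y x
  E-sym {x} {y} = subst T (adj-sym x y)

  open CheapestWalks {R = E G} {e = cost} E-sym (cost-sym w-sym)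

  G-uv-closed : Closed G-uv
  G-uv-closed (_ , _ , y∉) = tt , y∉

  h∈G-uv : V G-uv h
  h∈G-uv = tt , h≢u , h≢v

  component-V⁺ : ∀ {t} → H t → V (component G-uv h) t
  component-V⁺ r = Reach⇒V G-uv-closed r , r

  H? : ∀ t → Dec (H t)
  H? = Reach? G-uv-closed
    (λ x y → T? (adj x y) ×-dec ((¬? (x ≟ u) ×-dec ¬? (x ≟ v)) ×-dec (¬? (y ≟ u) ×-dec ¬? (y ≟ v)))) h∈G-uv

  H⇒≢ : ∀ {t} → H t → t ≢ u × t ≢ v
  H⇒≢ r = proj₂ (Reach⇒V G-uv-closed r)

  Cut : Fin n → Set
  Cut t = t ≡ u ⊎ t ≡ v

  -- An edge from `H` to a vertex other than `u` and `v` survives in `G-uv`, so its far end would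
  -- belong to the component.
  H-neighbour : ∀ {x y} → H x → E G x y → ¬ H y → Cut y
  H-neighbour {x} {y} hx e ¬hy with y ≟ u | y ≟ v
  ... | yes y≡u | _ = inj₁ y≡u
  ... | no _ | yes y≡v = inj₂ y≡v
  ... | no y≢u | no y≢v = contradiction (Reach-step G-uv-closed hx (e , H⇒≢ hx , y≢u , y≢v)) ¬hy

  -- The cut vertex is found in `xs`, after the start. In `outer-edge` this places it on the
  -- opposite side of the cycle from the one found by `entry`.
  exit : ∀ {a b xs} → Walk (E G) a xs b → H a → ¬ H b → ∃ λ s → s ∈ xs × Cut s
  exit [] ha ¬hb = contradiction ha ¬hb
  exit (_∷_ {c = c} r p) ha ¬hb with H? c
  ... | no ¬hc = c , here refl , H-neighbour ha r ¬hc
  ... | yes hc with s , s∈ , cut ← exit p hc ¬hb = s , there s∈ , cut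

  entry : ∀ {a b xs} → Walk (E G) a xs b → ¬ H a → H b → ∃ λ s → s ∈ a ∷ xs × Cut s
  entry [] ¬ha hb = contradiction hb ¬ha
  entry {a} (_∷_ {c = c} r p) ¬ha hb with H? c
  ... | yes hc = a , here refl , H-neighbour hc (E-sym r) ¬ha
  ... | no ¬hc with s , s∈ , cut ← entry p ¬hc hb = s , there s∈ , cut

  P-walk : ∃ λ xs → P ≡ u ∷ xs × Walk (E G) u xs v × StrictlyCheapest (E G) cost u xs v × Unique P
  P-walk with xs , refl , p , P! , _ ← IsPath⇒Walk {F = G} (proj₁ P-lsp) =
    xs , refl , p , IsLSP⇒strict {F = G} (λ _ → tt) P-lsp , P!

  P-segment : ∀ {c d} → c ∈ P → d ∈ P → Segment P c d
  P-segment c∈ d∈ with xs , refl , p , strict , _ ← P-walk = segment p strict c∈ d∈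

  P-edge : ∀ {x y} → PathEdge P x y → E G x y
  P-edge e with xs , refl , p , _ ← P-walk = edge p e
    where
    edge : ∀ {xs x y} → Walk (E G) u xs v → PathEdge (u ∷ xs) x y → E G x y
    edge p (inj₁ c) = Consec⇒related p c
    edge p (inj₂ c) = E-sym (Consec⇒related p c)

  Cut⇒∈P : ∀ {t} → Cut t → t ∈ P
  Cut⇒∈P cut with xs , refl , p , _ ← P-walk with cut
  ... | inj₁ refl = here refl
  ... | inj₂ refl = target∈ p

  ∈P⇒¬H : ∀ {t} → t ∈ P → ¬ H t
  ∈P⇒¬H t∈ r = P∩H=∅ _ t∈ (component-V⁺ r)

  -- The piece from `c` to `d` runs through `t` and has both ends on `P`, so it follows `P`.
  cheapest-between : ∀ {a b c d t ys zs} → Walk (E G) a ys t → Walk (E G) t zs b →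
                     Cheapest (E G) cost a (ys ++ zs) b → c ∈ a ∷ ys → d ∈ t ∷ zs → c ∈ P → d ∈ P →
                     t ∈ P
  cheapest-between {a} {b} {t = t} p q cheap c∈ d∈ c∈P d∈P
    with A , S₁ , refl , p₁ , p₂ ← Walk-split p c∈ | S₂ , D , refl , q₁ , q₂ ← Walk-split q d∈
    = proj₁ (cheapest-follows p₁ (p₂ ++ʷ q₁) q₂
        (subst (λ l → Cheapest (E G) cost a l b)
          (trans (++-assoc A S₁ (S₂ ++ D)) (cong (A ++_) (sym (++-assoc S₁ S₂ D)))) cheap)
        (P-segment c∈P d∈P)) (middle (target∈ p₂))
    where
    middle : ∀ {c} → t ∈ c ∷ S₁ → t ∈ c ∷ S₁ ++ S₂
    middle = ∈-++⁺ˡ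

  cheapest-edge-between : ∀ {a b c d x y ys zs} → Walk (E G) a ys x → E G x y → Walk (E G) y zs b →
                          Cheapest (E G) cost a (ys ++ y ∷ zs) b → c ∈ a ∷ ys → d ∈ y ∷ zs → c ∈ P → d ∈ P →
                          PathEdge P x y
  cheapest-edge-between {a} {b} {y = y} p r q cheap c∈ d∈ c∈P d∈P
    with A , S₁ , refl , p₁ , p₂ ← Walk-split p c∈ | S₂ , D , refl , q₁ , q₂ ← Walk-split q d∈
    = proj₂ (cheapest-follows p₁ (p₂ ++ʷ r ∷ q₁) q₂
        (subst (λ l → Cheapest (E G) cost a l b)
          (trans (++-assoc A S₁ (y ∷ S₂ ++ D)) (cong (A ++_) (sym (++-assoc S₁ (y ∷ S₂) D)))) cheap)
        (P-segment c∈P d∈P)) (Consec-middle p₂ y S₂)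

  -- The two pieces of `G` and their lex short cycles

  K₁ K₂ : Graph n
  K₁ = G₁ G u v h P
  K₂ = G₂ G u v h

  H-edge : ∀ {x y} → H x ⊎ H y → E G x y → E K₁ x y
  H-edge {x} {y} (inj₁ hx) e with H? y
  ... | yes hy = inj₁ ((e , H⇒≢ hx , H⇒≢ hy) , hx , hy)
  ... | no ¬hy = inj₂ (inj₂ (e , inj₁ (component-V⁺ hx , H-neighbour hx e ¬hy)))
  H-edge {x} {y} (inj₂ hy) e with H? x
  ... | yes hx = inj₁ ((e , H⇒≢ hx , H⇒≢ hy) , hx , hy)
  ... | no ¬hx = inj₂ (inj₂ (e , inj₂ (component-V⁺ hy , H-neighbour hy (E-sym e) ¬hx)))

  K₁-edge : ∀ {x y} → E G x y → (¬ H x → ¬ H y → PathEdge P x y) → E K₁ x y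
  K₁-edge {x} {y} e f with H? x | H? y
  ... | yes hx | _ = H-edge (inj₁ hx) e
  ... | no _ | yes hy = H-edge (inj₂ hy) e
  ... | no ¬hx | no ¬hy = inj₂ (inj₁ (f ¬hx ¬hy))

  K₁-edge⁻ : ∀ {x y} → E K₁ x y → ¬ H x → ¬ H y → PathEdge P x y
  K₁-edge⁻ (inj₁ (_ , hx , _)) ¬hx _ = contradiction hx ¬hx
  K₁-edge⁻ (inj₂ (inj₁ e)) _ _ = e
  K₁-edge⁻ (inj₂ (inj₂ (_ , inj₁ (hx , _)))) ¬hx _ = contradiction (proj₂ hx) ¬hx
  K₁-edge⁻ (inj₂ (inj₂ (_ , inj₂ (hy , _)))) _ ¬hy = contradiction (proj₂ hy) ¬hy

  K₁⊑G : K₁ ⊑ G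
  K₁⊑G = record { V⊆ = λ _ → tt ; E⊆ = E⊆ ; closed = closed ; symmetric = symmetric }
    where
    E⊆ : ∀ {x y} → E K₁ x y → E G x y
    E⊆ (inj₁ ((e , _) , _)) = e
    E⊆ (inj₂ (inj₁ e)) = P-edge e
    E⊆ (inj₂ (inj₂ (e , _))) = e
    closed : Closed K₁
    closed (inj₁ (_ , _ , hy)) = inj₁ (component-V⁺ hy)
    closed (inj₂ (inj₁ (inj₁ c))) = inj₂ (proj₂ (Consec⇒∈ c))
    closed (inj₂ (inj₁ (inj₂ c))) = inj₂ (proj₁ (Consec⇒∈ c))
    closed (inj₂ (inj₂ (_ , inj₁ (_ , cut)))) = inj₂ (Cut⇒∈P cut)
    closed (inj₂ (inj₂ (_ , inj₂ (hy , _)))) = inj₁ hy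
    symmetric : ∀ {x y} → E K₁ x y → E K₁ y x
    symmetric (inj₁ ((e , x≢ , y≢) , hx , hy)) = inj₁ ((E-sym e , y≢ , x≢) , hy , hx)
    symmetric (inj₂ (inj₁ (inj₁ c))) = inj₂ (inj₁ (inj₂ c))
    symmetric (inj₂ (inj₁ (inj₂ c))) = inj₂ (inj₁ (inj₁ c))
    symmetric (inj₂ (inj₂ (e , inj₁ hx))) = inj₂ (inj₂ (E-sym e , inj₂ hx))
    symmetric (inj₂ (inj₂ (e , inj₂ hy))) = inj₂ (inj₂ (E-sym e , inj₁ hy))

  K₂-vertex : ∀ {t} → ¬ H t → V K₂ t
  K₂-vertex ¬ht = tt , λ ht → ¬ht (proj₂ ht)

  K₂-vertex⁻ : ∀ {t} → V K₂ t → ¬ H t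
  K₂-vertex⁻ (_ , ¬ht) ht = ¬ht (component-V⁺ ht)

  K₂⊑G : K₂ ⊑ G
  K₂⊑G = record
    { V⊆ = λ _ → tt
    ; E⊆ = proj₁
    ; closed = λ (_ , _ , y∈) → tt , y∈
    ; symmetric = λ (e , x∈ , y∈) → E-sym e , y∈ , x∈
    }

  -- Only an edge with both ends outside `H` could leave `K₁`. Before it the walk has met `P`,
  -- either at its start or at the cut vertex through which it left `H`; the same holds after it, so
  -- the edge lies on `P`.
  cheapest-in-K₁ : ∀ {a b ys} → V K₁ a → V K₁ b → Walk (E G) a ys b → Cheapest (E G) cost a ys b → Walk (E K₁) a ys b
  cheapest-in-K₁ {a} {b} va vb p cheap = Walk-map (λ con e → K₁-edge e (on-P con)) p
    where
    P-before : ∀ {x ys} → V K₁ a → Walk (E G) a ys x → ¬ H x → ∃ λ c → c ∈ a ∷ ys × c ∈ P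
    P-before (inj₂ a∈P) q ¬hx = a , here refl , a∈P
    P-before (inj₁ (_ , ha)) q ¬hx with s , s∈ , cut ← exit q ha ¬hx = s , there s∈ , Cut⇒∈P cut
    P-after : ∀ {y zs} → V K₁ b → Walk (E G) y zs b → ¬ H y → ∃ λ d → d ∈ y ∷ zs × d ∈ P
    P-after (inj₂ b∈P) q ¬hy = b , target∈ q , b∈P
    P-after (inj₁ (_ , hb)) q ¬hy with s , s∈ , cut ← entry q ¬hy hb = s , s∈ , Cut⇒∈P cut
    on-P : ∀ {x y} → Consec _ x y → ¬ H x → ¬ H y → PathEdge P x y
    on-P con ¬hx ¬hy
      with _ , _ , refl , p₁ , r , p₂ ← Walk-split-edge p con
      with c , c∈ , c∈P ← P-before va p₁ ¬hx | d , d∈ , d∈P ← P-after vb p₂ ¬hy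
      = cheapest-edge-between p₁ r p₂ cheap c∈ d∈ c∈P d∈P

  -- A visit to `H` begins and ends through cut vertices, which lie on `P`; the visited vertex would
  -- then lie on `P`, which avoids `H`.
  cheapest-in-K₂ : ∀ {a b ys} → V K₂ a → V K₂ b → Walk (E G) a ys b → Cheapest (E G) cost a ys b → Walk (E K₂) a ys b
  cheapest-in-K₂ {a} {b} {ys} va vb p cheap = Walk-map
    (λ con e → e , proj₂ (K₂-vertex (avoids (proj₁ (Consec⇒∈ con)))) , proj₂ (K₂-vertex (avoids (proj₂ (Consec⇒∈ con))))) p
    where
    avoids : ∀ {t} → t ∈ a ∷ ys → ¬ H t
    avoids t∈ ht
      with _ , _ , refl , p₁ , p₂ ← Walk-split p t∈
      with c , c∈ , cut-c ← entry p₁ (K₂-vertex⁻ va) ht | d , d∈ , cut-d ← exit p₂ ht (K₂-vertex⁻ vb)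
      = ∈P⇒¬H (cheapest-between p₁ p₂ cheap c∈ (there d∈) (Cut⇒∈P cut-c) (Cut⇒∈P cut-d)) ht

  -- Going round C from p in both directions one leaves H through u and through v, so P ⊆ C;
  -- as P avoids p it joins u to v on the other side of C, hence through xy.
  outer-edge : ∀ {C p x y} → IsLSC _≺_ w G C → p ∈ C → H p → Consec (close C) x y → ¬ H x → ¬ H y → PathEdge P x y
  outer-edge {C} {p} {x} {y} ((_ , C! , _ , l) , lsps) p∈ hp con ¬hx ¬hy = split-at-p
    where
    open Opened (open-at l con)
    opened! : Unique (y ∷ rest)
    opened! = Unique-resp-↭ (↭-sym ↭C) C!
    split-at-p : PathEdge P x y
    split-at-p
      with ys , zs , eq , p₁ , p₂ ← Walk-split walk (∈-resp-↭ (↭-sym ↭C) p∈)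
      with s , s∈ , cut ← entry p₁ ¬hy hp | s′ , s′∈ , cut′ ← exit p₂ hp ¬hx
      = ends cut cut′ s∈ s′∈
      where
      parts! : Unique (y ∷ ys ++ zs)
      parts! = subst (λ r → Unique (y ∷ r)) eq opened!
      disjoint : ∀ {t} → t ∈ y ∷ ys → ¬ t ∈ zs
      disjoint = Unique-disjoint (y ∷ ys) parts!
      parts⊆C : ∀ {t} → t ∈ y ∷ ys ++ zs → t ∈ C
      parts⊆C t∈ = ∈-resp-↭ ↭C (subst (λ r → _ ∈ y ∷ r) (sym eq) t∈)
      C⊆parts : ∀ {t} → t ∈ C → t ∈ y ∷ ys ⊎ t ∈ zs
      C⊆parts t∈ = ∈-++⁻ (y ∷ ys) (subst (λ r → _ ∈ y ∷ r) eq (∈-resp-↭ (↭-sym ↭C) t∈))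
      P⊆C : u ∈ C → v ∈ C → (∀ t → t ∈ P → t ∈ C) × (∀ c d → PathEdge P c d → CycEdge C c d)
      P⊆C u∈ v∈ with Q , Q-lsp , sub ← lsps u v u∈ v∈
                with refl ← IsLSP-unique {F = G} (λ _ → tt) P-lsp Q-lsp = sub
      -- In the opened cycle the two sides meet only at the edge leaving `p`, the last vertex of
      -- `y ∷ ys`, and `p` is not on `P`.
      not-consecutive : ∀ {c d} → Consec (y ∷ rest) c d → c ∈ P → d ∈ P →
                        ¬ ((c ∈ y ∷ ys × d ∈ zs) ⊎ (c ∈ zs × d ∈ y ∷ ys))
      not-consecutive {c} {d} con c∈P d∈P sides
        with Consec-++ʷ⁻ p₁ (subst (λ r → Consec (y ∷ r) c d) eq con) | sides
      ... | inj₁ con′ | inj₁ (_ , d∈) = disjoint (proj₂ (Consec⇒∈ con′)) d∈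
      ... | inj₁ con′ | inj₂ (c∈ , _) = disjoint (proj₁ (Consec⇒∈ con′)) c∈
      ... | inj₂ con′ | inj₁ (c∈ , _) = disjoint c∈ (Any.tail (λ { refl → ∈P⇒¬H c∈P hp }) (proj₁ (Consec⇒∈ con′)))
      ... | inj₂ con′ | inj₂ (_ , d∈) = disjoint d∈ (Any.tail (λ { refl → ∈P⇒¬H d∈P hp }) (proj₂ (Consec⇒∈ con′)))
      P-crosses : ∀ {c d} → CycEdge C c d → PathEdge P c d → c ∈ P → d ∈ P →
                  (c ∈ y ∷ ys × d ∈ zs) ⊎ (c ∈ zs × d ∈ y ∷ ys) → PathEdge P x y
      P-crosses (inj₁ con) e c∈ d∈ sides with to con
      ... | inj₁ con′ = contradiction sides (not-consecutive con′ c∈ d∈)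
      ... | inj₂ (refl , refl) = e
      P-crosses (inj₂ con) e c∈ d∈ sides with to con
      ... | inj₁ con′ = contradiction (exchange sides) (not-consecutive con′ d∈ c∈)
        where
        exchange : ∀ {A B C D : Set} → (A × B) ⊎ (C × D) → (D × C) ⊎ (B × A)
        exchange (inj₁ (a , b)) = inj₂ (b , a)
        exchange (inj₂ (c , d)) = inj₁ (d , c)
      ... | inj₂ (refl , refl) = swap e
      -- The two cut vertices are distinct, since the sides are disjoint; hence `P` starts on one
      -- side and ends on the other.
      ends : ∀ {s s′} → Cut s → Cut s′ → s ∈ y ∷ ys → s′ ∈ zs → PathEdge P x y
      ends (inj₁ refl) (inj₁ refl) s∈ s′∈ = contradiction s′∈ (disjoint s∈)
      ends (inj₂ refl) (inj₂ refl) s∈ s′∈ = contradiction s′∈ (disjoint s∈)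
      ends (inj₁ refl) (inj₂ refl) s∈ s′∈
        with V⊆ , E⊆ ← P⊆C (parts⊆C (∈-++⁺ˡ s∈)) (parts⊆C (∈-++⁺ʳ (y ∷ ys) s′∈))
        with xs , refl , q , _ ← P-walk
        with c , d , con , c∈ , d∈ ← Walk-crossing q (λ t∈ → C⊆parts (V⊆ _ t∈)) disjoint s∈ s′∈
        = P-crosses (E⊆ c d (inj₁ con)) (inj₁ con) (proj₁ (Consec⇒∈ con)) (proj₂ (Consec⇒∈ con)) (inj₁ (c∈ , d∈))
      ends (inj₂ refl) (inj₁ refl) s∈ s′∈
        with V⊆ , E⊆ ← P⊆C (parts⊆C (∈-++⁺ʳ (y ∷ ys) s′∈)) (parts⊆C (∈-++⁺ˡ s∈))
        with xs , refl , q , _ ← P-walk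
        with c , d , con , c∈ , d∈ ← Walk-crossing q (λ t∈ → swap (C⊆parts (V⊆ _ t∈)))
                                       (λ t∈ t∈′ → disjoint t∈′ t∈) s′∈ s∈
        = P-crosses (E⊆ c d (inj₁ con)) (inj₁ con) (proj₁ (Consec⇒∈ con)) (proj₂ (Consec⇒∈ con)) (inj₂ (c∈ , d∈))

  LSC⇒K₁⊎K₂ : ∀ {C} → IsLSC _≺_ w G C → IsLSC _≺_ w K₁ C ⊎ IsLSC _≺_ w K₂ C
  LSC⇒K₁⊎K₂ {C} lsc@((_ , _ , _ , l) , _) with Any.any? H? C
  ... | no none = inj₂ (IsLSC-restrict K₂⊑G lsc (λ t∈ → K₂-vertex (outside t∈))
          λ con → Linked⇒related l con , proj₂ (K₂-vertex (outside (proj₁ (Consec-close⇒∈ con))))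
                                       , proj₂ (K₂-vertex (outside (proj₂ (Consec-close⇒∈ con)))))
    where
    outside : ∀ {t} → t ∈ C → ¬ H t
    outside t∈ ht = none (Any.map (λ { refl → ht }) t∈)
  ... | yes some with p , p∈ , hp ← find some =
    -- Each vertex of the cycle is an end of one of its edges, so the vertices lie in `K₁` because
    -- the edges do.
    inj₁ (IsLSC-restrict K₁⊑G lsc (λ t∈ → _⊑_.closed K₁⊑G (_⊑_.symmetric K₁⊑G (edge (proj₂ (successor t∈))))) edge)
    where
    edge : ∀ {x y} → Consec (close C) x y → E K₁ x y
    edge con = K₁-edge (Linked⇒related l con) (outer-edge lsc p∈ hp con)

  K₁⊎K₂⇒LSC : ∀ {C} → IsLSC _≺_ w K₁ C ⊎ IsLSC _≺_ w K₂ C → IsLSC _≺_ w G C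
  K₁⊎K₂⇒LSC (inj₁ lsc) = IsLSC-extend K₁⊑G cheapest-in-K₁ lsc
  K₁⊎K₂⇒LSC (inj₂ lsc) = IsLSC-extend K₂⊑G cheapest-in-K₂ lsc

  -- Vertices of `K₂` lie outside `H`, and an edge of `K₁` with both ends outside `H` belongs to
  -- `P`.
  K₁∩K₂-acyclic : ∀ {C} → IsCycle K₁ C → ¬ IsCycle K₂ C
  K₁∩K₂-acyclic {C} cyc₁@(_ , _ , _ , l) (_ , _ , vs , _) with _ , _ , _ , _ , P! ← P-walk =
    cycle⊈path {F = K₁} cyc₁ P P! λ con → K₁-edge⁻ (Linked⇒related l con)
      (outside (proj₁ (Consec-close⇒∈ con))) (outside (proj₂ (Consec-close⇒∈ con)))
    where
    outside : ∀ {t} → t ∈ C → ¬ H t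
    outside t∈ = K₂-vertex⁻ (All.lookup vs t∈)

theorem3 : ∀ {n : ℕ} (adj : Fin n → Fin n → Bool) (w : Fin n → Fin n → ℕ)
    (_≺_ : Fin n → Fin n → Set) →
    IsStrictTotalOrder _≡_ _≺_ →
    (∀ a b → adj a b ≡ adj b a) → (∀ a → adj a a ≡ false) →
    (∀ a b → w a b ≡ w b a) →
    Connected (fromAdj adj) → Partial2Tree (fromAdj adj) →
    ¬ Outerplanar (fromAdj adj) →
    (u v : Fin n) →
    Σ (Fin n) (λ x → Σ (Fin n) (λ y → Σ (Fin n) (λ z →
    K23Subdivision (fromAdj adj) u v x y z))) →
    AtLeast3Components (delete2 (fromAdj adj) u v) →
    (P : List (Fin n)) → IsLSP _≺_ w (fromAdj adj) u v P →
    (h : Fin n) → h ≢ u → h ≢ v →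
    (∀ t → t ∈ P → ¬ V (component (delete2 (fromAdj adj) u v) h) t) →
    (∀ a b → PathEdge P a b → ¬ E (component (delete2 (fromAdj adj) u v) h) a b) →
    (∀ C →
    (IsLSC _≺_ w (fromAdj adj) C ⇔
    (IsLSC _≺_ w (G₁ (fromAdj adj) u v h P) C ⊎
    IsLSC _≺_ w (G₂ (fromAdj adj) u v h) C)) ×
    ¬ (IsLSC _≺_ w (G₁ (fromAdj adj) u v h P) C ×
    IsLSC _≺_ w (G₂ (fromAdj adj) u v h) C))
theorem3 adj w _≺_ sto adj-sym _ w-sym _ _ _ u v _ _ P P-lsp h h≢u h≢v P∩H=∅ _ C =
  mk⇔ LSC⇒K₁⊎K₂ K₁⊎K₂⇒LSC , λ ((cyc₁ , _) , (cyc₂ , _)) → K₁∩K₂-acyclic cyc₁ cyc₂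
  where open Separation sto adj adj-sym w w-sym u v P P-lsp h h≢u h≢v P∩H=∅
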